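{- There exist universal constants $0 < C_{\mathrm{lb}} < C_{\mathrm{ub}}$ such that the following hold. (1) Every satisfiable sentence $\varphi$ of the Guarded Fragment $\mathrm{GF}$ has a finite model whose domain size is at most $2^{2^{\,C_{\mathrm{ub}}\cdot |\varphi|\cdot\log|\varphi|}}$. (2) For every $n \in \mathbb{N}$ there exists a satisfiable $\mathrm{GF}$-sentence $\varphi_n$ with $|\varphi_n| \ge n$ such that every model of $\varphi_n$ has domain size at least $2^{2^{\,C_{\mathrm{lb}}\cdot |\varphi_n|\cdot\log|\varphi_n|}}$.
   Context: We work in first-order logic with equality, with relation symbols of arbitrary arity and constant symbols, but no function symbols of positive arity. The Guarded Fragment $\mathrm{GF}$ is the smallest set of first-order formulas such that: (i) every atomic formula (including equality atoms) is in $\mathrm{GF}$; (ii) $\mathrm{GF}$ is closed under Boolean connectives; (iii) if $\bar x$ is a tuple of variables, $\psi \in \mathrm{GF}$, and $\gamma$ is an atomic formula (the guard) such that all free variables of $\psi$ and all variables of $\bar x$ occur in $\gamma$, then $\exists \bar x\,(\gamma \wedge \psi)$ and $\forall \bar x\,(\gamma \rightarrow \psi)$ are in $\mathrm{GF}$. The length $|\varphi|$ of a formula is its uniform length: the formula is viewed as a word over an infinite alphabet of parentheses, connectives, quantifiers, variables, relation symbols and constants, and each symbol occurrence contributes $1$. -}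

module Defs where

open import Data.Nat using (ℕ; zero; suc; _+_; _*_; _^_; _≤_; _<_)
open import Data.Nat.Properties using (_≟_)
open import Data.Integer using (∣_∣)
open import Data.Rational using (ℚ; ↥_; ↧ₙ_)
open import Data.List using (List; []; _∷_; _++_; length; concatMap; filter)
open import Data.List.Relation.Unary.All using (All)
open import Data.List.Membership.Propositional using (_∈_)
open import Data.List.Membership.DecPropositional _≟_ using (_∈?_)
open import Data.Vec using (Vec; toList; map)
open import Data.Product using (Σ; _×_; _,_)
open import Relation.Nullary using (¬_; yes; no; ¬?)
open import Relation.Binary.PropositionalEquality using (_≡_)

data Term : Set where
  var : ℕ → Term
  con : ℕ → Term

record RelSym : Set where
  constructor rsym
  field
    name  : ℕ
    arity : ℕ

data Atom : Set where
  rel : (R : RelSym) → Vec Term (RelSym.arity R) → Atom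
  eqA : Term → Term → Atom

data Formula : Set where
  atom : Atom → Formula
  ¬'   : Formula → Formula
  _∧'_ : Formula → Formula → Formula
  _∨'_ : Formula → Formula → Formula
  _⇒'_ : Formula → Formula → Formula
  _⇔'_ : Formula → Formula → Formula
  ∃'   : List ℕ → Formula → Formula
  ∀'   : List ℕ → Formula → Formula

termVars : Term → List ℕ
termVars (var x) = x ∷ []
termVars (con c) = []

atomVars : Atom → List ℕ
atomVars (rel R ts) = concatMap termVars (toList ts)
atomVars (eqA s t)  = termVars s ++ termVars t

fv : Formula → List ℕ
fv (atom a)  = atomVars a
fv (¬' φ)    = fv φ
fv (φ ∧' ψ)  = fv φ ++ fv ψ
fv (φ ∨' ψ)  = fv φ ++ fv ψ
fv (φ ⇒' ψ)  = fv φ ++ fv ψ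
fv (φ ⇔' ψ)  = fv φ ++ fv ψ
fv (∃' xs φ) = filter (λ y → ¬? (y ∈? xs)) (fv φ)
fv (∀' xs φ) = filter (λ y → ¬? (y ∈? xs)) (fv φ)

Sentence : Formula → Set
Sentence φ = fv φ ≡ []

data GF : Formula → Set where
  gatom : ∀ a → GF (atom a)
  gneg  : ∀ {φ} → GF φ → GF (¬' φ)
  gand  : ∀ {φ ψ} → GF φ → GF ψ → GF (φ ∧' ψ)
  gor   : ∀ {φ ψ} → GF φ → GF ψ → GF (φ ∨' ψ)
  gimp  : ∀ {φ ψ} → GF φ → GF ψ → GF (φ ⇒' ψ)
  giff  : ∀ {φ ψ} → GF φ → GF ψ → GF (φ ⇔' ψ)
  gex   : ∀ xs γ {ψ} → GF ψ → All (_∈ atomVars γ) xs → All (_∈ atomVars γ) (fv ψ)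
          → GF (∃' xs (atom γ ∧' ψ))
  gall  : ∀ xs γ {ψ} → GF ψ → All (_∈ atomVars γ) xs → All (_∈ atomVars γ) (fv ψ)
          → GF (∀' xs (atom γ ⇒' ψ))

-- Uniform length: every symbol occurrence counts 1.
--   R(t1 ... tk) : R, '(', k terms, ')'       = k + 3
--   s = t        : s, '=', t                  = 3
--   ¬φ           : 1 + |φ|
--   (φ ∘ ψ)      : '(', φ, ∘, ψ, ')'          = 3 + |φ| + |ψ|
--   ∃x1..xk φ    : quantifier, k variables, φ = 1 + k + |φ|

atomLen : Atom → ℕ
atomLen (rel R ts) = 3 + RelSym.arity R
atomLen (eqA s t)  = 3

len : Formula → ℕ
len (atom a)  = atomLen a
len (¬' φ)    = 1 + len φ
len (φ ∧' ψ)  = 3 + len φ + len ψ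
len (φ ∨' ψ)  = 3 + len φ + len ψ
len (φ ⇒' ψ)  = 3 + len φ + len ψ
len (φ ⇔' ψ)  = 3 + len φ + len ψ
len (∃' xs φ) = 1 + length xs + len φ
len (∀' xs φ) = 1 + length xs + len φ

-- Semantics (structures with nonempty domain). Truth is interpreted
-- classically via the Gödel–Gentzen negative translation.

record Structure : Set₁ where
  field
    Carrier : Set
    elem    : Carrier
    relI    : (R : RelSym) → Vec Carrier (RelSym.arity R) → Set
    conI    : ℕ → Carrier

module Sem (M : Structure) where
  open Structure M

  Env : Set
  Env = ℕ → Carrier

  upd : Env → ℕ → Carrier → Env
  upd ρ x d y with y ≟ x
  ... | yes _ = d
  ... | no  _ = ρ y

  evalT : Env → Term → Carrier
  evalT ρ (var x) = ρ x
  evalT ρ (con c) = conI c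

  exQ : List ℕ → Env → (Env → Set) → Set
  exQ []       ρ P = P ρ
  exQ (x ∷ xs) ρ P = ¬ ((d : Carrier) → ¬ exQ xs (upd ρ x d) P)

  allQ : List ℕ → Env → (Env → Set) → Set
  allQ []       ρ P = P ρ
  allQ (x ∷ xs) ρ P = (d : Carrier) → allQ xs (upd ρ x d) P

  satA : Env → Atom → Set
  satA ρ (rel R ts) = ¬ ¬ relI R (map (evalT ρ) ts)
  satA ρ (eqA s t)  = ¬ ¬ (evalT ρ s ≡ evalT ρ t)

  sat : Env → Formula → Set
  sat ρ (atom a)  = satA ρ a
  sat ρ (¬' φ)    = ¬ sat ρ φ
  sat ρ (φ ∧' ψ)  = sat ρ φ × sat ρ ψ
  sat ρ (φ ∨' ψ)  = ¬ (¬ sat ρ φ × ¬ sat ρ ψ)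
  sat ρ (φ ⇒' ψ)  = sat ρ φ → sat ρ ψ
  sat ρ (φ ⇔' ψ)  = (sat ρ φ → sat ρ ψ) × (sat ρ ψ → sat ρ φ)
  sat ρ (∃' xs φ) = exQ xs ρ (λ σ → sat σ φ)
  sat ρ (∀' xs φ) = allQ xs ρ (λ σ → sat σ φ)

-- M ⊨ φ (for sentences the environment is irrelevant)
_⊨_ : Structure → Formula → Set
M ⊨ φ = Sem.sat M (λ _ → Structure.elem M) φ

Satisfiable : Formula → Set₁
Satisfiable φ = Σ Structure (λ M → M ⊨ φ)

-- Size bounds without reals.  For C = p/q > 0 (p = numerator,
-- q = denominator), n ≥ 1, m ≥ 1, write T = 2^(C·n·log₂ n) = n^(p·n/q).
--   m ≤ 2^(2^(C·n·log₂ n))  ⇔  log₂ m ≤ T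
--     ⇔ for all naturals a, b ≥ 1 with 2^a < m^b : (a/b)^q ≤ n^(p·n)
--   m ≥ 2^(2^(C·n·log₂ n))  ⇔  log₂ m ≥ T
--     ⇔ for all naturals a, b ≥ 1 with m^b < 2^a : (a/b)^q ≥ n^(p·n)
-- (density of the rationals a/b in the reals).

DExpAtMost′ : (p q n m : ℕ) → Set
DExpAtMost′ p q n m = ∀ a b → 1 ≤ b → 2 ^ a < m ^ b → a ^ q ≤ b ^ q * n ^ (p * n)

DExpAtLeast′ : (p q n m : ℕ) → Set
DExpAtLeast′ p q n m = ∀ a b → 1 ≤ b → m ^ b < 2 ^ a → b ^ q * n ^ (p * n) ≤ a ^ q

DExpAtMost : ℚ → ℕ → ℕ → Set
DExpAtMost C = DExpAtMost′ ∣ ↥ C ∣ (↧ₙ C)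

DExpAtLeast : ℚ → ℕ → ℕ → Set
DExpAtLeast C = DExpAtLeast′ ∣ ↥ C ∣ (↧ₙ C)

{-# OPTIONS --safe #-}
-- Upper bound.  Let n = |φ| and M ⊨ φ.  A key is a subformula of φ together with an assignment of
-- its free variables to n levels and to the constants; there are n^O(n) keys.  The finite model
-- consists of the constants and of pairs (level, one bit per key).  Elements sitting on distinct
-- levels propose a truth value for each key by adding up, modulo 2, the bits of those elements whose
-- level the key mentions.  Facts are put on such a set of elements only if all proposed values are
-- those of some tuple of M, so every guarded tuple looks like a tuple of M.  Conversely, if a tuple
-- copies a tuple of M, any further element of M is copied by a fresh level: the bits of the new
-- element are a free summand in every key that mentions its level, so they can be adjusted to give
-- exactly the required values.  Satisfaction being interpreted classically, all this happens under a
-- double negation, and the model is then found by exhaustive search among the structures of that size.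
--
-- Lower bound.  From k distinct letters, kept in a tuple closed under rotation, all k^k words of
-- length k are generated by pushing the first letter.  Every node x carries one bit P(x,w) per word,
-- and for each word some node differs from x in exactly that bit; hence all 2^(k^k) bit patterns
-- occur, while the sentence has length O(k).

module Submission where

open import Defs
open import Data.Nat using (ℕ; zero; suc; _+_; _*_; _^_; _≤_; z≤n; s≤s; s≤s⁻¹; NonZero; >-nonZero)
open import Data.Nat.Properties using (_≟_; _≤?_; *-assoc; *-comm; *-identityʳ; *-identityˡ; *-mono-≤; *-monoʳ-≤; *-monoˡ-≤; *-suc; +-assoc; +-comm; +-identityʳ; +-mono-≤; +-monoʳ-≤; +-monoˡ-≤; +-suc; <⇒≢; <⇒≤; <⇒≱; [m*n]*[o*p]≡[m*o]*[n*p]; ^-*-assoc; ^-distribˡ-+-*; ^-identityʳ; ^-monoʳ-≤; ^-monoˡ-≤; m*n≢0; m^n>0; m^n≢0; m≤m*n; m≤m+n; m≤n+m; m≤n⇒m<n∨m≡n; m≤n⇒m≤1+n; n≤1+n; suc-injective; ≤-refl; ≤-reflexive; ≤-trans; ≤⇒≯; ≤∧≢⇒<; ≮⇒≥; module ≤-Reasoning)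
open import Data.Nat.Tactic.RingSolver using (solve-∀)
open import Data.Bool using (Bool; true; false; not; _xor_; if_then_else_)
open import Data.Bool.Properties using () renaming (_≟_ to _≟ᵇ_)
open import Data.Fin using (Fin; zero; suc; toℕ; fromℕ<; _↑ˡ_; _↑ʳ_; splitAt; join; remQuot; combine; funToFin; finToFun)
open import Data.Fin.Properties using (any?; all?; injective⇒≤; toℕ-fromℕ<; toℕ-injective; toℕ<n; splitAt-↑ˡ; splitAt-↑ʳ; splitAt⁻¹-↑ˡ; splitAt⁻¹-↑ʳ; splitAt-join; ↑ʳ-injective; remQuot-combine; finToFun-funToFin; funToFin-finToFin) renaming (_≟_ to _≟ᶠ_)
import Data.List as List
open import Data.List using (List; []; _∷_; _++_; length; concatMap; upTo)
open import Data.List.Properties using (length-++; length-filter; length-map; length-upTo; filter-none; ++-assoc; ++-identityʳ) renaming (∷-injectiveˡ to headL; ∷-injectiveʳ to tailL)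
open import Data.List.Relation.Unary.Any using (Any; here; there; index)
import Data.List.Relation.Unary.Any as Any
open import Data.List.Relation.Unary.Any.Properties using (lookup-index)
open import Data.List.Relation.Unary.All using (All; []; _∷_)
import Data.List.Relation.Unary.All as All
open import Data.List.Membership.Propositional using (_∈_; _∉_; find; lose)
open import Data.List.Membership.Propositional.Properties using (∈-++⁺ˡ; ∈-++⁺ʳ; ∈-++⁻; ∈-filter⁺; ∈-filter⁻; ∈-map⁺; ∈-concatMap⁺; ∈-∃++; ∈-upTo⁺; ∈-upTo⁻)
open import Data.List.Membership.DecPropositional _≟_ using (_∈?_)
open import Data.List.Membership.DecPropositional using () renaming (_∈?_ to mem?)
import Data.Vec as Vec
open import Data.Vec using (Vec; []; _∷_; _∷ʳ_; toList; lookup; tabulate; head; tail) renaming (_++_ to _++ᵛ_)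
open import Data.Vec.Properties using (lookup∘tabulate; tabulate∘lookup; tabulate-cong; toList-∷ʳ; map-++; map-∷ʳ; ++-injective; ∷-injectiveˡ; ∷-injectiveʳ) renaming (≡-dec to Vec-≡-dec)
import Data.Vec.Membership.Propositional.Properties as VecMem
open import Data.Vec.Relation.Unary.All using () renaming (All to AllV; [] to []ᵛ; _∷_ to _∷ᵛ_)
open import Data.Vec.Relation.Unary.AllPairs using ([]; _∷_)
open import Data.Vec.Relation.Unary.Unique.Propositional using (Unique)
import Data.Vec.Relation.Unary.Unique.Propositional.Properties as Unique
open import Data.Product using (Σ; _×_; _,_; proj₁; proj₂)
open import Data.Sum using (_⊎_; inj₁; inj₂; [_,_]′)
open import Data.Sum.Properties using (inj₁-injective) renaming (≡-dec to ⊎-≡-dec)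
open import Data.Unit using (⊤; tt)
open import Data.Empty using (⊥)
open import Function using (_∘_; id)
open import Function.Bundles using (_↔_; _↣_; Injection)
open import Function.Construct.Identity using (↔-id)
open import Relation.Nullary using (¬_; Dec; yes; no; ¬?; contradiction)
open import Relation.Nullary.Decidable using (does; map′; _×-dec_; _⊎-dec_; _→-dec_; decidable-stable; from-yes; ¬¬-excluded-middle)
open import Relation.Binary.Definitions using (DecidableEquality)
open import Relation.Binary.PropositionalEquality using (_≡_; _≢_; refl; sym; trans; cong; cong₂; subst; subst₂; module ≡-Reasoning)

-- The upper bound hinges on counting. A key names levels, not elements, and n levels suffice
-- because the free and the quantified variables of a quantified subformula together number at most
-- n; so there are about n^(2n) keys, and the elements cost only one more exponential than the keys.
-- The obstacle is consistency: two guarded tuples that share elements must agree on every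
-- subformula about the shared ones. Since a truth value is a sum of bits owned by single elements,
-- it depends on the mentioned elements alone, and agreement is automatic. Keys range over all
-- subformulas and not only over atoms because the truth of a quantified formula, established in one
-- tuple, has to be carried to another tuple that shares just its free variables. In the lower bound
-- the obstacle is length: one axiom of length O(k) per letter, or one inequality per pair of
-- letters, would cost k^2 symbols. Rotation lets a statement about the first letter speak about
-- every letter, so a fixed number of axioms of length O(k) is enough, while log(k^k) = k log k.

infixl 1 _>>=_
_>>=_ : ∀ {a b} {A : Set a} {B : Set b} → ¬ ¬ A → (A → ¬ ¬ B) → ¬ ¬ B
(m >>= f) k = m (λ x → f x k)

return : ∀ {a} {A : Set a} → A → ¬ ¬ A
return x k = k x

¬¬-∀Fin : ∀ {a} n {P : Fin n → Set a} → (∀ i → ¬ ¬ P i) → ¬ ¬ (∀ i → P i)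
¬¬-∀Fin zero    h = return λ ()
¬¬-∀Fin (suc n) h = do
  p ← h zero
  q ← ¬¬-∀Fin n (h ∘ suc)
  return λ { zero → p ; (suc i) → q i }

-- Satisfaction: quantifier blocks, stability under double negation, dependence on free variables.

module SemProps (M : Structure) where
  open Structure M
  open Sem M

  upd-≡ : ∀ ρ x d → upd ρ x d x ≡ d
  upd-≡ ρ x d with x ≟ x
  ... | yes _ = refl
  ... | no ne = contradiction refl ne

  upd-≢ : ∀ ρ x d {y} → y ≢ x → upd ρ x d y ≡ ρ y
  upd-≢ ρ x d {y} ne with y ≟ x
  ... | yes e = contradiction e ne
  ... | no _  = refl

  updAll : Env → List ℕ → Env → Env
  updAll ρ []       σ = ρ
  updAll ρ (x ∷ xs) σ = updAll (upd ρ x (σ x)) xs σ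

  updAll-agree : ∀ xs {ρ σ x} → ρ x ≡ σ x → updAll ρ xs σ x ≡ σ x
  updAll-agree []       e = e
  updAll-agree (y ∷ xs) {ρ} {σ} {x} e = updAll-agree xs agree
    where
    agree : upd ρ y (σ y) x ≡ σ x
    agree with x ≟ y
    ... | yes refl = refl
    ... | no _     = e

  updAll-∈ : ∀ {xs ρ σ x} → x ∈ xs → updAll ρ xs σ x ≡ σ x
  updAll-∈ {y ∷ xs} {ρ} (here refl) = updAll-agree xs (upd-≡ ρ y _)
  updAll-∈ {y ∷ xs} (there i) = updAll-∈ i

  updAll-∉ : ∀ xs {ρ σ x} → x ∉ xs → updAll ρ xs σ x ≡ ρ x
  updAll-∉ []       ni = refl
  updAll-∉ (y ∷ xs) {ρ} ni =
    trans (updAll-∉ xs (ni ∘ there)) (upd-≢ ρ y _ λ e → ni (here e))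

  exQ-intro : ∀ xs {ρ P} σ → P (updAll ρ xs σ) → exQ xs ρ P
  exQ-intro []       σ p   = p
  exQ-intro (x ∷ xs) σ p k = k (σ x) (exQ-intro xs σ p)

  exQ-elim : ∀ xs {ρ P} → exQ xs ρ P →
    ¬ ¬ Σ Env λ σ → (∀ {x} → x ∉ xs → σ x ≡ ρ x) × P σ
  exQ-elim []       {ρ} h k = k (ρ , (λ _ → refl) , h)
  exQ-elim (x ∷ xs) {ρ} h k = h λ d e →
    exQ-elim xs e λ (σ , off , p) →
      k (σ , (λ ni → trans (off (ni ∘ there)) (upd-≢ ρ x d λ e → ni (here e))) , p)

  exQ-stable : ∀ xs {ρ P} → (∀ σ → ¬ ¬ P σ → P σ) → ¬ ¬ exQ xs ρ P → exQ xs ρ P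
  exQ-stable []       st h   = st _ h
  exQ-stable (x ∷ xs) st h k = h λ e → e k

  allQ-elim : ∀ xs {ρ P} → allQ xs ρ P → ∀ σ → P (updAll ρ xs σ)
  allQ-elim []       h σ = h
  allQ-elim (x ∷ xs) h σ = allQ-elim xs (h (σ x)) σ

  allQ-intro : ∀ xs {ρ P} → (∀ σ → (∀ {x} → x ∉ xs → σ x ≡ ρ x) → P σ) → allQ xs ρ P
  allQ-intro []       {ρ} h   = h ρ λ _ → refl
  allQ-intro (x ∷ xs) {ρ} h d = allQ-intro xs λ σ off →
    h σ λ ni → trans (off (ni ∘ there)) (upd-≢ ρ x d λ e → ni (here e))

  allQ⇒¬exQ : ∀ xs {ρ P Q} → (∀ σ → P σ → ¬ Q σ) → allQ xs ρ P → ¬ exQ xs ρ Q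
  allQ⇒¬exQ []       h p q = h _ p q
  allQ⇒¬exQ (x ∷ xs) h p q = q λ d → allQ⇒¬exQ xs h (p d)

  ¬exQ⇒allQ : ∀ xs {ρ P Q} → (∀ σ → ¬ Q σ → P σ) → ¬ exQ xs ρ Q → allQ xs ρ P
  ¬exQ⇒allQ []       h nq   = h _ nq
  ¬exQ⇒allQ (x ∷ xs) h nq d = ¬exQ⇒allQ xs h λ q → nq λ k → k d q

  -- Every clause of the translation is negative. Hence excluded middle may be used, under a double
  -- negation, whenever the goal is a satisfaction statement.
  sat-stable : ∀ φ {ρ} → ¬ ¬ sat ρ φ → sat ρ φ
  sat-stable (atom (rel R ts)) h k = h λ s → s k
  sat-stable (atom (eqA s t))  h k = h λ e → e k
  sat-stable (¬' φ)   h s = h λ n → n s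
  sat-stable (φ ∧' ψ) h = sat-stable φ (λ k → h (k ∘ proj₁)) , sat-stable ψ (λ k → h (k ∘ proj₂))
  sat-stable (φ ∨' ψ) h k = h λ n → n k
  sat-stable (φ ⇒' ψ) h s = sat-stable ψ λ k → h λ f → k (f s)
  sat-stable (φ ⇔' ψ) h = (λ s → sat-stable ψ λ k → h λ f → k (proj₁ f s))
                        , (λ s → sat-stable φ λ k → h λ f → k (proj₂ f s))
  sat-stable (∃' xs φ) h = exQ-stable xs (λ _ → sat-stable φ) h
  sat-stable (∀' xs φ) {ρ} h = stable xs h
    where
    stable : ∀ xs {ρ} → ¬ ¬ allQ xs ρ (λ σ → sat σ φ) → allQ xs ρ (λ σ → sat σ φ)
    stable []       h   = sat-stable φ h
    stable (x ∷ xs) h d = stable xs λ k → h λ f → k (f d)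

  evalT-cong : ∀ t {ρ σ} → (∀ {x} → x ∈ termVars t → ρ x ≡ σ x) → evalT ρ t ≡ evalT σ t
  evalT-cong (var x) h = h (here refl)
  evalT-cong (con c) h = refl

  evalTs-cong : ∀ {n} (ts : Vec Term n) {ρ σ} →
    (∀ {x} → x ∈ concatMap termVars (toList ts) → ρ x ≡ σ x) →
    Vec.map (evalT ρ) ts ≡ Vec.map (evalT σ) ts
  evalTs-cong []       h = refl
  evalTs-cong (t ∷ ts) h = cong₂ _∷_ (evalT-cong t (h ∘ ∈-++⁺ˡ))
                                     (evalTs-cong ts (h ∘ ∈-++⁺ʳ (termVars t)))

  Agree : List ℕ → Env → Env → Set
  Agree xs ρ σ = ∀ {x} → x ∈ xs → ρ x ≡ σ x

  -- Environments are functions that can only be compared pointwise, and most of them are controlled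
  -- only on the variables at hand. This congruence stands in for equality of environments from here
  -- on.
  sat-cong : ∀ φ {ρ σ} → Agree (fv φ) ρ σ → sat ρ φ → sat σ φ
  sat-cong (atom (rel R ts)) h s k = s (k ∘ subst (relI R) (evalTs-cong ts h))
  sat-cong (atom (eqA t u)) h s k = s λ e → k
    (trans (sym (evalT-cong t (h ∘ ∈-++⁺ˡ)))
      (trans e (evalT-cong u (h ∘ ∈-++⁺ʳ (termVars t)))))
  sat-cong (¬' φ) h s s' = s (sat-cong φ (λ i → sym (h i)) s')
  sat-cong (φ ∧' ψ) h (s , t) = sat-cong φ (h ∘ ∈-++⁺ˡ) s , sat-cong ψ (h ∘ ∈-++⁺ʳ (fv φ)) t
  sat-cong (φ ∨' ψ) h s (nf , ng) =
    s (nf ∘ sat-cong φ (h ∘ ∈-++⁺ˡ) , ng ∘ sat-cong ψ (h ∘ ∈-++⁺ʳ (fv φ)))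
  sat-cong (φ ⇒' ψ) h s f =
    sat-cong ψ (h ∘ ∈-++⁺ʳ (fv φ)) (s (sat-cong φ (λ i → sym (h (∈-++⁺ˡ i))) f))
  sat-cong (φ ⇔' ψ) h (s , t) =
      (λ f → sat-cong ψ (h ∘ ∈-++⁺ʳ (fv φ)) (s (sat-cong φ (λ i → sym (h (∈-++⁺ˡ i))) f)))
    , (λ g → sat-cong φ (h ∘ ∈-++⁺ˡ) (t (sat-cong ψ (λ i → sym (h (∈-++⁺ʳ (fv φ) i))) g)))
  sat-cong (∃' xs φ) {ρ} {σ} h s = exQ-stable xs (λ _ → sat-stable φ) do
    μ , off , p ← exQ-elim xs s
    return (exQ-intro xs μ (sat-cong φ (agree μ off) p))
    where
    agree : ∀ μ → (∀ {x} → x ∉ xs → μ x ≡ ρ x) → Agree (fv φ) μ (updAll σ xs μ)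
    agree μ off {x} i with x ∈? xs
    ... | yes j = sym (updAll-∈ j)
    ... | no nj = trans (off nj) (trans (h (∈-filter⁺ (λ y → ¬? (y ∈? xs)) i nj)) (sym (updAll-∉ xs nj)))
  sat-cong (∀' xs φ) {ρ} {σ} h s = allQ-intro xs λ μ off →
    sat-cong φ (agree μ off) (allQ-elim xs s μ)
    where
    agree : ∀ μ → (∀ {x} → x ∉ xs → μ x ≡ σ x) → Agree (fv φ) (updAll ρ xs μ) μ
    agree μ off {x} i with x ∈? xs
    ... | yes j = updAll-∈ j
    ... | no nj = trans (updAll-∉ xs nj) (trans (h (∈-filter⁺ (λ y → ¬? (y ∈? xs)) i nj)) (sym (off nj)))

-- Finite structures as codes that can be searched exhaustively.

Omniscient : Set → Set₁
Omniscient A = (P : A → Set) → (∀ x → Dec (P x)) → Dec (Σ A P)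

Omniscient-Fin : ∀ n → Omniscient (Fin n)
Omniscient-Fin n P P? = any? P?

Omniscient-Bool : Omniscient Bool
Omniscient-Bool P P? = map′ [ (true ,_) , (false ,_) ]′
  (λ { (true , p) → inj₁ p ; (false , p) → inj₂ p }) (P? true ⊎-dec P? false)

Omniscient-× : {A B : Set} → Omniscient A → Omniscient B → Omniscient (A × B)
Omniscient-× sA sB P P? = map′ (λ (x , y , p) → (x , y) , p) (λ ((x , y) , p) → x , y , p)
  (sA (λ x → Σ _ λ y → P (x , y)) λ x → sB (λ y → P (x , y)) λ y → P? (x , y))

Omniscient-Vec : {A : Set} → Omniscient A → ∀ n → Omniscient (Vec A n)
Omniscient-Vec sA zero    P P? = map′ ([] ,_) (λ { ([] , p) → p }) (P? [])
Omniscient-Vec sA (suc n) P P? = map′ (λ ((x , xs) , p) → x ∷ xs , p) (λ { (x ∷ xs , p) → (x , xs) , p })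
  (Omniscient-× sA (Omniscient-Vec sA n) (λ (x , xs) → P (x ∷ xs)) λ _ → P? _)

Omniscient-All : {A : Set} {F : A → Set} → (∀ x → Omniscient (F x)) → ∀ xs → Omniscient (All F xs)
Omniscient-All sF []       P P? = map′ ([] ,_) (λ { ([] , p) → p }) (P? [])
Omniscient-All sF (x ∷ xs) P P? = map′ (λ ((y , ys) , p) → y ∷ ys , p) (λ { (y ∷ ys , p) → (y , ys) , p })
  (Omniscient-× (sF x) (Omniscient-All sF xs) (λ (y , ys) → P (y ∷ ys)) λ _ → P? _)

_≟ʳ_ : DecidableEquality RelSym
rsym n k ≟ʳ rsym n′ k′ = map′ (λ (p , q) → cong₂ rsym p q)
  (λ e → cong RelSym.name e , cong RelSym.arity e) (n ≟ n′ ×-dec k ≟ k′)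

open import Data.List.Membership.DecPropositional _≟ʳ_ using () renaming (_∈?_ to _∈ʳ?_)

module Coding (m : ℕ) (Rs : List RelSym) (cs : List ℕ) where

  Table : RelSym → Set
  Table R = Vec Bool (m ^ RelSym.arity R)

  -- Only the symbols in `Rs` and `cs` receive an interpretation of their own, so a structure on
  -- `Fin m` becomes finite data.
  Code : Set
  Code = Fin m × All Table Rs × All (λ _ → Fin m) cs

  Omniscient-Code : Omniscient Code
  Omniscient-Code = Omniscient-× (Omniscient-Fin m)
    (Omniscient-× (Omniscient-All (λ R → Omniscient-Vec Omniscient-Bool _) Rs)
                  (Omniscient-All (λ _ → Omniscient-Fin m) cs))

  entry : ∀ R → Table R → Vec (Fin m) (RelSym.arity R) → Bool
  entry R t v = Vec.lookup t (funToFin (Vec.lookup v))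

  -- The membership decision is an argument so that later proofs can split on it directly.
  relTable : All Table Rs → ∀ {R} → Dec (R ∈ Rs) → Vec (Fin m) (RelSym.arity R) → Set
  relTable ts {R} (yes i) v = entry R (All.lookup ts i) v ≡ true
  relTable ts (no _)  v = ⊥

  conTable : Fin m → All (λ _ → Fin m) cs → ∀ {c} → Dec (c ∈ cs) → Fin m
  conTable d ks (yes i) = All.lookup ks i
  conTable d ks (no _)  = d

  decode : Code → Structure
  decode (d , ts , ks) = record
    { Carrier = Fin m
    ; elem    = d
    ; relI    = λ R → relTable ts (R ∈ʳ? Rs)
    ; conI    = λ c → conTable d ks (c ∈? cs)
    }

  module _ (C : Code) where
    open Structure (decode C)
    open Sem (decode C)

    relTable? : ∀ ts {R} (i : Dec (R ∈ Rs)) v → Dec (relTable ts i v)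
    relTable? ts {R} (yes i) v = entry R (All.lookup ts i) v ≟ᵇ true
    relTable? ts (no _)  v = no λ ()

    exQ? : ∀ xs ρ {P} → (∀ σ → Dec (P σ)) → Dec (exQ xs ρ P)
    exQ? []       ρ P? = P? ρ
    exQ? (x ∷ xs) ρ P? = ¬? (all? λ d → ¬? (exQ? xs (upd ρ x d) P?))

    allQ? : ∀ xs ρ {P} → (∀ σ → Dec (P σ)) → Dec (allQ xs ρ P)
    allQ? []       ρ P? = P? ρ
    allQ? (x ∷ xs) ρ P? = all? λ d → allQ? xs (upd ρ x d) P?

    sat? : ∀ φ ρ → Dec (sat ρ φ)
    sat? (atom (rel R ts)) ρ = ¬? (¬? (relTable? (proj₁ (proj₂ C)) (R ∈ʳ? Rs) _))
    sat? (atom (eqA s t))  ρ = ¬? (¬? (evalT ρ s ≟ᶠ evalT ρ t))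
    sat? (¬' φ)    ρ = ¬? (sat? φ ρ)
    sat? (φ ∧' ψ)  ρ = sat? φ ρ ×-dec sat? ψ ρ
    sat? (φ ∨' ψ)  ρ = ¬? (¬? (sat? φ ρ) ×-dec ¬? (sat? ψ ρ))
    sat? (φ ⇒' ψ)  ρ = sat? φ ρ →-dec sat? ψ ρ
    sat? (φ ⇔' ψ)  ρ = (sat? φ ρ →-dec sat? ψ ρ) ×-dec (sat? ψ ρ →-dec sat? φ ρ)
    sat? (∃' xs φ) ρ = exQ? xs ρ (sat? φ)
    sat? (∀' xs φ) ρ = allQ? xs ρ (sat? φ)

  model? : ∀ φ → Dec (Σ Code λ C → decode C ⊨ φ)
  model? φ = Omniscient-Code (λ C → decode C ⊨ φ) λ C → sat? C φ _

  module _ (Q : ∀ R → Vec (Fin m) (RelSym.arity R) → Set) where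

    Represents : ∀ {R} → Table R → Set
    Represents {R} t = ∀ v → (entry R t v ≡ true → Q R v) × (Q R v → entry R t v ≡ true)

    -- A relation on `Fin m` has finitely many instances, so excluded middle can be invoked for all
    -- of them under one double negation. This applies even to a `Q` that quantifies over an
    -- infinite structure.
    table : ∀ R → ¬ ¬ Σ (Table R) (Represents {R})
    table R = do
      Q? ← ¬¬-∀Fin (m ^ RelSym.arity R) λ i → ¬¬-excluded-middle {A = Q R (Vec.tabulate (finToFun i))}
      return (Vec.tabulate (does ∘ Q?) , represents Q?)
      where
      vec≡ : ∀ (v : Vec (Fin m) (RelSym.arity R)) → Vec.tabulate (finToFun (funToFin (Vec.lookup v))) ≡ v
      vec≡ v = trans (tabulate-cong (finToFun-funToFin (Vec.lookup v))) (tabulate∘lookup v)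

      represents : (Q? : ∀ i → Dec (Q R (Vec.tabulate (finToFun i)))) → Represents {R} (Vec.tabulate (does ∘ Q?))
      represents Q? v with Q? (funToFin (Vec.lookup v)) | lookup∘tabulate (does ∘ Q?) (funToFin (Vec.lookup v))
      ... | yes q | e = (λ _ → subst (Q R) (vec≡ v) q) , λ _ → e
      ... | no nq | e = (λ e′ → contradiction (trans (sym e) e′) λ ())
                      , λ q → contradiction (subst (Q R) (sym (vec≡ v)) q) nq

    tables : ∀ Rs → ¬ ¬ Σ (All Table Rs) λ ts → ∀ {R} (i : R ∈ Rs) → Represents {R} (All.lookup ts i)
    tables []       = return ([] , λ ())
    tables (R ∷ Rs) = do
      t , p   ← table R
      ts , ps ← tables Rs
      return (t ∷ ts , λ { (here refl) → p ; (there i) → ps i })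

    constants : (κ : ℕ → Fin m) → ∀ cs →
      Σ (All (λ _ → Fin m) cs) λ ks → ∀ {c} (i : c ∈ cs) → All.lookup ks i ≡ κ c
    constants κ []       = [] , λ ()
    constants κ (c ∷ cs) = let ks , ps = constants κ cs in
      κ c ∷ ks , λ { (here refl) → refl ; (there i) → ps i }

    realise : Fin m → (κ : ℕ → Fin m) → ¬ ¬ Σ Code λ C → let open Structure (decode C) in
        (∀ {R} → R ∈ Rs → ∀ v → (relI R v → Q R v) × (Q R v → relI R v))
      × (∀ {c} → c ∈ cs → conI c ≡ κ c)
    realise d κ = do
      ts , ps ← tables Rs
      return ((d , ts , proj₁ (constants κ cs))
             , (λ {R} → relations ts ps (R ∈ʳ? Rs)) , (λ {c} → constants-correct (c ∈? cs)))
      where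
      relations : ∀ ts (ps : ∀ {R} (i : R ∈ Rs) → Represents {R} (All.lookup ts i)) →
        ∀ {R} (i? : Dec (R ∈ Rs)) → R ∈ Rs → ∀ v → (relTable ts i? v → Q R v) × (Q R v → relTable ts i? v)
      relations ts ps (yes i) _ = ps i
      relations ts ps (no ni) i = contradiction i ni

      constants-correct : ∀ {c} (i? : Dec (c ∈ cs)) → c ∈ cs → conTable d (proj₁ (constants κ cs)) i? ≡ κ c
      constants-correct (yes i) _ = proj₂ (constants κ cs) i
      constants-correct (no ni) i = contradiction i ni

-- Subformulas and symbols of a formula, counted against its length.

subs : Formula → List Formula
subs (atom a)  = atom a ∷ []
subs (¬' φ)    = ¬' φ ∷ subs φ
subs (φ ∧' ψ)  = (φ ∧' ψ) ∷ subs φ ++ subs ψ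
subs (φ ∨' ψ)  = (φ ∨' ψ) ∷ subs φ ++ subs ψ
subs (φ ⇒' ψ)  = (φ ⇒' ψ) ∷ subs φ ++ subs ψ
subs (φ ⇔' ψ)  = (φ ⇔' ψ) ∷ subs φ ++ subs ψ
subs (∃' xs φ) = ∃' xs φ ∷ subs φ
subs (∀' xs φ) = ∀' xs φ ∷ subs φ

termCons : Term → List ℕ
termCons (var x) = []
termCons (con c) = c ∷ []

atomCons : Atom → List ℕ
atomCons (rel R ts) = concatMap termCons (toList ts)
atomCons (eqA s t)  = termCons s ++ termCons t

topCons : Formula → List ℕ
topCons (atom a) = atomCons a
topCons _        = []

topRels : Formula → List RelSym
topRels (atom (rel R ts)) = R ∷ []
topRels _                 = []

cons : Formula → List ℕ
cons φ = concatMap topCons (subs φ)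

rels : Formula → List RelSym
rels φ = concatMap topRels (subs φ)

private
  length-+ : ∀ {A : Set} (xs : List A) {ys m n} → length xs ≤ m → length ys ≤ n → length (xs ++ ys) ≤ m + n
  length-+ xs {ys} p q rewrite length-++ xs {ys} = +-mono-≤ p q

  length-++-≤ : ∀ {A : Set} (xs : List A) {ys m n} → length xs ≤ m → length ys ≤ n → length (xs ++ ys) ≤ 3 + m + n
  length-++-≤ xs p q = ≤-trans (length-+ xs p q) (m≤n+m _ 3)

  suc-length-++-≤ : ∀ {A : Set} (xs : List A) {ys m n} → length xs ≤ m → length ys ≤ n → suc (length (xs ++ ys)) ≤ 3 + m + n
  suc-length-++-≤ xs p q = s≤s (≤-trans (length-+ xs p q) (m≤n+m _ 2))

  length-concatMap-++ : ∀ {A B : Set} (f : A → List B) xs {ys m n} →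
    length (concatMap f xs) ≤ m → length (concatMap f ys) ≤ n → length (concatMap f (xs ++ ys)) ≤ m + n
  length-concatMap-++ f []       p q = ≤-trans q (m≤n+m _ _)
  length-concatMap-++ f (x ∷ xs) {ys} {m} {n} p q = begin
    length (f x ++ concatMap f (xs ++ ys))                    ≤⟨ length-+ (f x) ≤-refl (length-concatMap-++ f xs ≤-refl q) ⟩
    length (f x) + (length (concatMap f xs) + n)              ≡⟨ +-assoc (length (f x)) _ n ⟨
    length (f x) + length (concatMap f xs) + n                ≡⟨ cong (_+ n) (length-++ (f x)) ⟨
    length (f x ++ concatMap f xs) + n                        ≤⟨ +-monoˡ-≤ n p ⟩
    m + n                                                     ∎
    where open ≤-Reasoning

  length-concatMap-Vec : ∀ {A : Set} (f : Term → List A) → (∀ t → length (f t) ≤ 1) →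
    ∀ {n} (ts : Vec Term n) → length (concatMap f (toList ts)) ≤ n
  length-concatMap-Vec f h []       = z≤n
  length-concatMap-Vec f h (t ∷ ts) rewrite length-++ (f t) {concatMap f (toList ts)} =
    +-mono-≤ (h t) (length-concatMap-Vec f h ts)

  length-termVars : ∀ t → length (termVars t) ≤ 1
  length-termVars (var x) = ≤-refl
  length-termVars (con c) = z≤n

  length-termCons : ∀ t → length (termCons t) ≤ 1
  length-termCons (var x) = z≤n
  length-termCons (con c) = ≤-refl

length-subs : ∀ φ → length (subs φ) ≤ len φ
length-subs (atom (rel R ts)) = s≤s z≤n
length-subs (atom (eqA s t))  = s≤s z≤n
length-subs (¬' φ)    = s≤s (length-subs φ)
length-subs (φ ∧' ψ)  = suc-length-++-≤ (subs φ) (length-subs φ) (length-subs ψ)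
length-subs (φ ∨' ψ)  = suc-length-++-≤ (subs φ) (length-subs φ) (length-subs ψ)
length-subs (φ ⇒' ψ)  = suc-length-++-≤ (subs φ) (length-subs φ) (length-subs ψ)
length-subs (φ ⇔' ψ)  = suc-length-++-≤ (subs φ) (length-subs φ) (length-subs ψ)
length-subs (∃' xs φ) = s≤s (≤-trans (length-subs φ) (m≤n+m _ (length xs)))
length-subs (∀' xs φ) = s≤s (≤-trans (length-subs φ) (m≤n+m _ (length xs)))

length-fv : ∀ φ → length (fv φ) ≤ len φ
length-fv (atom (rel R ts)) = ≤-trans (length-concatMap-Vec termVars length-termVars ts) (m≤n+m _ 3)
length-fv (atom (eqA s t))  = ≤-trans (length-+ (termVars s) (length-termVars s) (length-termVars t)) (n≤1+n 2)
length-fv (¬' φ)    = m≤n⇒m≤1+n (length-fv φ)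
length-fv (φ ∧' ψ)  = length-++-≤ (fv φ) (length-fv φ) (length-fv ψ)
length-fv (φ ∨' ψ)  = length-++-≤ (fv φ) (length-fv φ) (length-fv ψ)
length-fv (φ ⇒' ψ)  = length-++-≤ (fv φ) (length-fv φ) (length-fv ψ)
length-fv (φ ⇔' ψ)  = length-++-≤ (fv φ) (length-fv φ) (length-fv ψ)
length-fv (∃' xs φ) = ≤-trans (length-filter _ (fv φ)) (≤-trans (length-fv φ) (m≤n+m _ (1 + length xs)))
length-fv (∀' xs φ) = ≤-trans (length-filter _ (fv φ)) (≤-trans (length-fv φ) (m≤n+m _ (1 + length xs)))

private
  cons-++ : ∀ φ ψ → length (cons φ) ≤ len φ → length (cons ψ) ≤ len ψ →
    length (concatMap topCons (subs φ ++ subs ψ)) ≤ 3 + len φ + len ψ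
  cons-++ φ ψ p q = ≤-trans (length-concatMap-++ topCons (subs φ) p q) (m≤n+m _ 3)

length-cons : ∀ φ → length (cons φ) ≤ len φ
length-cons (atom (rel R ts)) = ≤-trans (length-+ (atomCons (rel R ts)) (length-concatMap-Vec termCons length-termCons ts) z≤n)
  (≤-trans (≤-reflexive (+-comm _ 0)) (m≤n+m _ 3))
length-cons (atom (eqA s t))  = ≤-trans
  (length-+ (termCons s ++ termCons t) (length-+ (termCons s) (length-termCons s) (length-termCons t)) z≤n) (n≤1+n 2)
length-cons (¬' φ)    = m≤n⇒m≤1+n (length-cons φ)
length-cons (φ ∧' ψ)  = cons-++ φ ψ (length-cons φ) (length-cons ψ)
length-cons (φ ∨' ψ)  = cons-++ φ ψ (length-cons φ) (length-cons ψ)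
length-cons (φ ⇒' ψ)  = cons-++ φ ψ (length-cons φ) (length-cons ψ)
length-cons (φ ⇔' ψ)  = cons-++ φ ψ (length-cons φ) (length-cons ψ)
length-cons (∃' xs φ) = ≤-trans (length-cons φ) (m≤n+m _ (1 + length xs))
length-cons (∀' xs φ) = ≤-trans (length-cons φ) (m≤n+m _ (1 + length xs))

len-subs : ∀ φ {ψ} → ψ ∈ subs φ → len ψ ≤ len φ
private
  len-subs-++ : ∀ φ ψ {χ} → χ ∈ subs φ ++ subs ψ → len χ ≤ 3 + len φ + len ψ
len-subs (atom a)  (here refl) = ≤-refl
len-subs (¬' φ)    (here refl) = ≤-refl
len-subs (φ ∧' ψ)  (here refl) = ≤-refl
len-subs (φ ∨' ψ)  (here refl) = ≤-refl
len-subs (φ ⇒' ψ)  (here refl) = ≤-refl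
len-subs (φ ⇔' ψ)  (here refl) = ≤-refl
len-subs (∃' xs φ) (here refl) = ≤-refl
len-subs (∀' xs φ) (here refl) = ≤-refl
len-subs (¬' φ)    (there i) = m≤n⇒m≤1+n (len-subs φ i)
len-subs (φ ∧' ψ)  (there i) = len-subs-++ φ ψ i
len-subs (φ ∨' ψ)  (there i) = len-subs-++ φ ψ i
len-subs (φ ⇒' ψ)  (there i) = len-subs-++ φ ψ i
len-subs (φ ⇔' ψ)  (there i) = len-subs-++ φ ψ i
len-subs (∃' xs φ) (there i) = ≤-trans (len-subs φ i) (m≤n+m _ (1 + length xs))
len-subs (∀' xs φ) (there i) = ≤-trans (len-subs φ i) (m≤n+m _ (1 + length xs))
len-subs-++ φ ψ i with ∈-++⁻ (subs φ) i
... | inj₁ j = ≤-trans (len-subs φ j) (≤-trans (m≤m+n _ (len ψ)) (m≤n+m _ 3))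
... | inj₂ j = ≤-trans (len-subs ψ j) (m≤n+m _ (3 + len φ))

-- Sums modulo 2, pointwise updates, and fresh levels.

xsum : ∀ {k} → (Fin k → Bool) → Bool
xsum {zero}  g = false
xsum {suc k} g = g zero xor xsum (g ∘ suc)

xsum-cong : ∀ {k} {g h : Fin k → Bool} → (∀ l → g l ≡ h l) → xsum g ≡ xsum h
xsum-cong {zero}  e = refl
xsum-cong {suc k} e = cong₂ _xor_ (e zero) (xsum-cong (e ∘ suc))

xsum-false : ∀ {k} {g : Fin k → Bool} → (∀ l → g l ≡ false) → xsum g ≡ false
xsum-false {zero}  e = refl
xsum-false {suc k} e = cong₂ _xor_ (e zero) (xsum-false (e ∘ suc))

without : ∀ {k} → Fin k → (Fin k → Bool) → Fin k → Bool
without l g l′ = if does (l′ ≟ᶠ l) then false else g l′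

without-cong : ∀ {k} (l : Fin k) {g h} → (∀ l′ → l′ ≢ l → g l′ ≡ h l′) → ∀ l′ → without l g l′ ≡ without l h l′
without-cong l e l′ with l′ ≟ᶠ l
... | yes _ = refl
... | no ne = e l′ ne

-- With the summand at `l` isolated, the bit of an element on that level can be solved for.
xsum-split : ∀ {k} (l : Fin k) g → xsum g ≡ g l xor xsum (without l g)
xsum-split zero    g = refl
xsum-split (suc l) g = trans (cong (g zero xor_) (trans (xsum-split l (g ∘ suc))
    (cong (g (suc l) xor_) (xsum-cong shift)))) (swap (g zero) (g (suc l)) _)
  where
  shift : ∀ l′ → without l (g ∘ suc) l′ ≡ without (suc l) g (suc l′)
  shift l′ with l′ ≟ᶠ l
  ... | yes _ = refl
  ... | no _  = refl
  swap : ∀ a b c → a xor (b xor c) ≡ b xor (a xor c)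
  swap false b c = refl
  swap true false c = refl
  swap true true false = refl
  swap true true true = refl

module _ {A B : Set} (_≟ᴬ_ : DecidableEquality A) where

  update : A → B → (A → B) → A → B
  update x v f y with y ≟ᴬ x
  ... | yes _ = v
  ... | no _  = f y

  update-≡ : ∀ x v f → update x v f x ≡ v
  update-≡ x v f with x ≟ᴬ x
  ... | yes _ = refl
  ... | no ne = contradiction refl ne

  update-≢ : ∀ x v f {y} → y ≢ x → update x v f y ≡ f y
  update-≢ x v f {y} ne with y ≟ᴬ x
  ... | yes e = contradiction e ne
  ... | no _  = refl


-- Pigeonhole: otherwise the position of a level in `X` would inject `Fin k` into a shorter list.
fresh : ∀ {k} (X : List (Fin k)) → suc (length X) ≤ k → Σ (Fin k) (_∉ X)
fresh {k} X h with any? (λ l → ¬? (mem? _≟ᶠ_ l X))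
... | yes p = p
... | no np = contradiction (injective⇒≤ {f = λ l → index (mem l)} λ {i} {j} e →
      trans (lookup-index (mem i)) (trans (cong (List.lookup X) e) (sym (lookup-index (mem j))))) (<⇒≱ h)
  where
  mem : ∀ l → l ∈ X
  mem l with mem? _≟ᶠ_ l X
  ... | yes i = i
  ... | no ni = contradiction (l , ni) np

All-vars : ∀ {A : Set} {P : A → Set} (ev : Term → A) {n} (ts : Vec Term n) → AllV P (Vec.map ev ts) →
  ∀ {x} → x ∈ concatMap termVars (toList ts) → P (ev (var x))
All-vars ev (var _ ∷ ts) (p ∷ᵛ ps) (here refl) = p
All-vars ev (var _ ∷ ts) (p ∷ᵛ ps) (there i)   = All-vars ev ts ps i
All-vars ev (con _ ∷ ts) (p ∷ᵛ ps) i           = All-vars ev ts ps i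

-- Copying tuples of `M` onto levels and bits.

module Amalgamation
  (M : Structure) (φ₀ : Formula) (k nc K : ℕ)
  (crep : Fin nc → Structure.Carrier M) (crep-injective : ∀ {i j} → crep i ≡ crep j → i ≡ j)
  (kf : Fin K → Formula) (ke : Fin K → ℕ → Fin k ⊎ Fin nc)
  (key : ∀ {ψ} → ψ ∈ subs φ₀ → (e : ℕ → Fin k ⊎ Fin nc) → Σ (Fin K) λ j → kf j ≡ ψ × (∀ {x : ℕ} → x ∈ fv ψ → ke j x ≡ e x))
  (F : Set) (bit : F → Fin K → Bool) (mkF : (Fin K → Bool) → F) (bit-mkF : ∀ g j → bit (mkF g) j ≡ g j)
  (β : Fin K → Bool)
  (β-correct : ∀ j →
     (β j ≡ true → Sem.sat M ([ (λ _ → Structure.elem M) , crep ]′ ∘ ke j) (kf j))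
     × (Sem.sat M ([ (λ _ → Structure.elem M) , crep ]′ ∘ ke j) (kf j) → β j ≡ true))
  where

  open Structure M
  open Sem M
  open SemProps M

  Lev : Set
  Lev = Fin k ⊎ Fin nc

  Touch : Fin k → Fin K → Set
  Touch l j = Any (λ x → ke j x ≡ inj₁ l) (fv (kf j))

  touch? : ∀ l j → Dec (Touch l j)
  touch? l j = Any.any? (λ x → ⊎-≡-dec _≟ᶠ_ _≟ᶠ_ (ke j x) (inj₁ l)) (fv (kf j))

  contrib : (Fin k → F) → Fin K → Fin k → Bool
  contrib s j l = if does (touch? l j) then bit (s l) j else false

  -- The summand `β` serves the keys that mention no level: no bit contributes to them, so their
  -- value must be their truth in `M` from the outset. For the other keys it is an arbitrary offset
  -- that the bits compensate.
  τ : (Fin k → F) → Fin K → Bool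
  τ s j = β j xor xsum (contrib s j)

  contrib-touch : ∀ s {j l} → Touch l j → contrib s j l ≡ bit (s l) j
  contrib-touch s {j} {l} t with touch? l j
  ... | yes _ = refl
  ... | no nt = contradiction t nt

  contrib-¬touch : ∀ s {j l} → ¬ Touch l j → contrib s j l ≡ false
  contrib-¬touch s {j} {l} nt with touch? l j
  ... | yes t = contradiction t nt
  ... | no _  = refl

  contrib-cong : ∀ s s′ {j} l → (Touch l j → s l ≡ s′ l) → contrib s j l ≡ contrib s′ j l
  contrib-cong s s′ {j} l h with touch? l j
  ... | yes t = cong (λ f → bit f j) (h t)
  ... | no _  = refl

  τ-cong : ∀ {s s′ j} → (∀ {l} → Touch l j → s l ≡ s′ l) → τ s j ≡ τ s′ j
  τ-cong {s} {s′} {j} h = cong (β j xor_) (xsum-cong λ l → contrib-cong s s′ l h)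

  In : List (Fin k) → Lev → Set
  In X (inj₁ l) = l ∈ X
  In X (inj₂ i) = ⊤

  Inside : List (Fin k) → Fin K → Set
  Inside X j = ∀ {x} → x ∈ fv (kf j) → In X (ke j x)

  In-mono : ∀ {X Y} → (∀ {l} → l ∈ X → l ∈ Y) → ∀ {a} → In X a → In Y a
  In-mono h {inj₁ l} i = h i
  In-mono h {inj₂ i} _ = tt

  touch-inside : ∀ {X j l} → Inside X j → Touch l j → l ∈ X
  touch-inside ins t with x , i , e ← find t = subst (In _) e (ins i)

  -- The bits `s` on the levels `X` describe the tuple `m` of `M` correctly. Only keys inside `X`
  -- are constrained, because the others involve levels whose elements are still to be chosen.
  -- Injectivity is what equality atoms demand: elements on different levels are different.
  record Good (X : List (Fin k)) (s : Fin k → F) (m : Lev → Carrier) : Set where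
    field
      m-cst : ∀ i → m (inj₂ i) ≡ crep i
      m-inj : ∀ {a b} → In X a → In X b → m a ≡ m b → a ≡ b
      sound : ∀ j → Inside X j → τ s j ≡ true → sat (m ∘ ke j) (kf j)
      complete : ∀ j → Inside X j → sat (m ∘ ke j) (kf j) → τ s j ≡ true

  Good-mono : ∀ {X Y s m} → (∀ {l} → l ∈ X → l ∈ Y) → Good Y s m → Good X s m
  Good-mono h g = record
    { m-cst    = m-cst
    ; m-inj    = λ p q → m-inj (In-mono h p) (In-mono h q)
    ; sound    = λ j ins → sound j (In-mono h ∘ ins)
    ; complete = λ j ins → complete j (In-mono h ∘ ins)
    } where open Good g

  -- A key inside the empty set of levels touches none, so its sum is empty and `β` alone decides.
  Good-base : ∀ s → Good [] s [ (λ _ → elem) , crep ]′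
  Good-base s = record
    { m-cst    = λ _ → refl
    ; m-inj    = λ { {inj₂ i} {inj₂ j} _ _ e → cong inj₂ (crep-injective e) }
    ; sound    = λ j ins e → proj₁ (β-correct j) (trans (sym (τ-base j ins)) e)
    ; complete = λ j ins p → trans (τ-base j ins) (proj₂ (β-correct j) p)
    }
    where
    xor-false : ∀ b → b xor false ≡ b
    xor-false false = refl
    xor-false true  = refl

    τ-base : ∀ j → Inside [] j → τ s j ≡ β j
    τ-base j ins = trans (cong (β j xor_) (xsum-false λ l → contrib-¬touch s {j} {l} λ t →
      contradiction (touch-inside {[]} {j} ins t) λ ())) (xor-false (β j))

  updateLev : Fin k → Carrier → (Lev → Carrier) → Lev → Carrier
  updateLev l a m = [ update _≟ᶠ_ l a (m ∘ inj₁) , m ∘ inj₂ ]′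

  module _ {X s m l a} (good : Good X s m) (l∉X : l ∉ X) (new : ∀ {b} → In X b → m b ≢ a) where
    open Good good

    private
      m′ : Lev → Carrier
      m′ = updateLev l a m

    updateLev-In : ∀ {b} → In X b → m′ b ≡ m b
    updateLev-In {inj₁ l′} i = update-≢ _≟ᶠ_ l a (m ∘ inj₁) λ { refl → l∉X i }
    updateLev-In {inj₂ _}  _ = refl

    -- The new element's own bits are a free summand of every key touching l,
    -- so they can be chosen to give each such key the truth value it has in M.
    extend : ¬ ¬ Σ F λ f → Good (l ∷ X) (update _≟ᶠ_ l f s) m′
    extend = do
      truth ← ¬¬-∀Fin K λ j → ¬¬-excluded-middle {A = sat (m′ ∘ ke j) (kf j)}
      return (_ , extended truth)
      where
      m′-l : m′ (inj₁ l) ≡ a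
      m′-l = update-≡ _≟ᶠ_ l a (m ∘ inj₁)

      uncons : ∀ {b} → In (l ∷ X) b → b ≡ inj₁ l ⊎ In X b
      uncons {inj₁ _} (here refl) = inj₁ refl
      uncons {inj₁ _} (there i)   = inj₂ i
      uncons {inj₂ _} _           = inj₂ tt

      inj′ : ∀ {b c} → In (l ∷ X) b → In (l ∷ X) c → m′ b ≡ m′ c → b ≡ c
      inj′ p q e with uncons p | uncons q
      ... | inj₁ refl | inj₁ refl = refl
      ... | inj₁ refl | inj₂ q′ = contradiction (trans (sym (updateLev-In q′)) (trans (sym e) m′-l)) (new q′)
      ... | inj₂ p′ | inj₁ refl = contradiction (trans (sym (updateLev-In p′)) (trans e m′-l)) (new p′)
      ... | inj₂ p′ | inj₂ q′ = m-inj p′ q′ (trans (sym (updateLev-In p′)) (trans e (updateLev-In q′)))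

      module _ (truth : ∀ j → Dec (sat (m′ ∘ ke j) (kf j))) where
        bits : Fin K → Bool
        -- `s` is total and already has some value at `l`; `without l` discards it before the
        -- equation is solved for the new bit.
        bits j = does (truth j) xor (β j xor xsum (without l (contrib s j)))

        f : F
        f = mkF bits

        s′ : Fin k → F
        s′ = update _≟ᶠ_ l f s

        cancel : ∀ b t w → b xor ((t xor (b xor w)) xor w) ≡ t
        cancel false false false = refl
        cancel false false true  = refl
        cancel false true  false = refl
        cancel false true  true  = refl
        cancel true  false false = refl
        cancel true  false true  = refl
        cancel true  true  false = refl
        cancel true  true  true  = refl

        τ-touch : ∀ j → Touch l j → τ s′ j ≡ does (truth j)
        τ-touch j t = begin
          β j xor xsum (contrib s′ j)
            ≡⟨ cong (β j xor_) (xsum-split l (contrib s′ j)) ⟩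
          β j xor (contrib s′ j l xor xsum (without l (contrib s′ j)))
            ≡⟨ cong₂ (λ p q → β j xor (p xor q))
                 (trans (contrib-touch s′ t) (trans (cong (λ f → bit f j) (update-≡ _≟ᶠ_ l f s)) (bit-mkF bits j)))
                 (xsum-cong (without-cong l λ l′ ne → contrib-cong s′ s l′ λ _ → update-≢ _≟ᶠ_ l f s ne)) ⟩
          β j xor (bits j xor xsum (without l (contrib s j)))
            ≡⟨ cancel (β j) (does (truth j)) (xsum (without l (contrib s j))) ⟩
          does (truth j) ∎
          where open ≡-Reasoning

        τ-¬touch : ∀ j → ¬ Touch l j → τ s′ j ≡ τ s j
        τ-¬touch j nt = τ-cong λ t → update-≢ _≟ᶠ_ l f s λ { refl → nt t }

        inside-old : ∀ j → ¬ Touch l j → Inside (l ∷ X) j → Inside X j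
        inside-old j nt ins {x} i with ke j x in eq | ins i
        ... | inj₁ _ | here refl = contradiction (lose i eq) nt
        ... | inj₁ _ | there p   = p
        ... | inj₂ _ | _         = tt

        extended : Good (l ∷ X) s′ m′
        extended = record
          { m-cst    = m-cst
          ; m-inj    = inj′
          ; sound    = sound′
          ; complete = complete′
          }
          where
          sound′ : ∀ j → Inside (l ∷ X) j → τ s′ j ≡ true → sat (m′ ∘ ke j) (kf j)
          sound′ j ins e with touch? l j
          ... | no nt = sat-cong (kf j) (λ i → sym (updateLev-In (inside-old j nt ins i)))
                          (sound j (inside-old j nt ins) (trans (sym (τ-¬touch j nt)) e))
          ... | yes t with truth j | τ-touch j t
          ...   | yes p | _  = p
          ...   | no _  | e′ = contradiction (trans (sym e′) e) λ ()
          complete′ : ∀ j → Inside (l ∷ X) j → sat (m′ ∘ ke j) (kf j) → τ s′ j ≡ true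
          complete′ j ins p with touch? l j
          ... | no nt = trans (τ-¬touch j nt) (complete j (inside-old j nt ins)
                          (sat-cong (kf j) (λ i → updateLev-In (inside-old j nt ins i)) p))
          ... | yes t with truth j | τ-touch j t
          ...   | yes _ | e′ = e′
          ...   | no np | _  = contradiction p np

  levels : (ℕ → Lev) → List ℕ → List (Fin k)
  levels e []       = []
  levels e (x ∷ xs) = [ _∷ levels e xs , (λ _ → levels e xs) ]′ (e x)

  length-levels : ∀ e xs → length (levels e xs) ≤ length xs
  length-levels e []       = z≤n
  length-levels e (x ∷ xs) with e x
  ... | inj₁ _ = s≤s (length-levels e xs)
  ... | inj₂ _ = m≤n⇒m≤1+n (length-levels e xs)

  In-levels : ∀ e {xs x} → x ∈ xs → In (levels e xs) (e x)
  In-levels e {x ∷ xs} (here refl) with e x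
  ... | inj₁ _ = here refl
  ... | inj₂ _ = tt
  In-levels e {y ∷ xs} (there i) with e y | In-levels e i
  ... | inj₁ _ | p = In-mono there p
  ... | inj₂ _ | p = p

  levels-⊆ : ∀ e xs {X l} → (∀ {x} → x ∈ xs → In X (e x)) → l ∈ levels e xs → l ∈ X
  levels-⊆ e (x ∷ xs) h i with e x | h (here refl)
  levels-⊆ e (x ∷ xs) h (here refl) | inj₁ _ | p = p
  levels-⊆ e (x ∷ xs) h (there i)   | inj₁ _ | p = levels-⊆ e xs (h ∘ there) i
  levels-⊆ e (x ∷ xs) h i           | inj₂ _ | p = levels-⊆ e xs (h ∘ there) i

  -- Pairs whose bits match no element of `M` are kept out of the domain, so that every element of
  -- the model lies in some good tuple. Equality guards rely on this, as they confine their
  -- variables to one arbitrary element.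
  Realised : Fin k × F → Set
  Realised (l , f) = Σ (Fin k → F) λ s → Σ (Lev → Carrier) λ m → Good (l ∷ []) s m × s l ≡ f

  -- The finite model and its frames.

  module Model (q : ℕ) (D : Fin q → Fin k × F) (i₀ : Fin nc)
    (D-realised : ∀ d → Realised (D d))
    (D-complete : ∀ y → Realised y → Σ (Fin q) λ d → D d ≡ y) where

    Dom : Set
    Dom = Fin (nc + q)

    cst : Fin nc → Dom
    cst i = i ↑ˡ q

    elt : Fin q → Dom
    elt d = nc ↑ʳ d

    level : Dom → Lev
    level v = [ inj₂ , inj₁ ∘ proj₁ ∘ D ]′ (splitAt nc v)

    level-cst : ∀ i → level (cst i) ≡ inj₂ i
    level-cst i = cong [ inj₂ , inj₁ ∘ proj₁ ∘ D ]′ (splitAt-↑ˡ nc i q)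

    level-elt : ∀ d → level (elt d) ≡ inj₁ (proj₁ (D d))
    level-elt d = cong [ inj₂ , inj₁ ∘ proj₁ ∘ D ]′ (splitAt-↑ʳ nc q d)

    -- A tuple of elements of the model together with the tuple of `M` that it copies. An element
    -- determines its level and its bits, so a frame has at most one element per level, and `pt`
    -- determines `s` on `X`.
    record Frame : Set where
      field
        X    : List (Fin k)
        s    : Fin k → F
        m    : Lev → Carrier
        good : Good X s m
        pt   : Lev → Dom
        pt-cst : ∀ i → pt (inj₂ i) ≡ cst i
        pt-elt : ∀ {l} → l ∈ X → Σ (Fin q) λ d → pt (inj₁ l) ≡ elt d × D d ≡ (l , s l)
      open Good good public

    open Frame

    level-pt : ∀ fr {a} → In (X fr) a → level (pt fr a) ≡ a
    level-pt fr {inj₁ l} i with d , p , e ← pt-elt fr i =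
      trans (cong level p) (trans (level-elt d) (cong (inj₁ ∘ proj₁) e))
    level-pt fr {inj₂ i} _ = trans (cong level (pt-cst fr i)) (level-cst i)

    same-bits : ∀ fr fr′ {l} → l ∈ X fr → l ∈ X fr′ → pt fr (inj₁ l) ≡ pt fr′ (inj₁ l) → s fr l ≡ s fr′ l
    same-bits fr fr′ i i′ e with d , p , r ← pt-elt fr i | d′ , p′ , r′ ← pt-elt fr′ i′
      with refl ← ↑ʳ-injective nc d d′ (trans (sym p) (trans e p′)) = cong proj₂ (trans (sym r) r′)

    Joint : Formula → (fr fr′ : Frame) → (e e′ : ℕ → Lev) → Set
    Joint ψ fr fr′ e e′ = ∀ {x} → x ∈ fv ψ → In (X fr) (e x) × In (X fr′) (e′ x) × pt fr (e x) ≡ pt fr′ (e′ x)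

    Transfer : Formula → Set
    Transfer ψ = ∀ fr fr′ {e e′} → Joint ψ fr fr′ e e′ → sat (m fr ∘ e) ψ → sat (m fr′ ∘ e′) ψ

    -- Both frames read the truth value of ψ off the same elements of the model.
    transfer : ∀ {ψ} → ψ ∈ subs φ₀ → Transfer ψ
    transfer ψ∈ fr fr′ {e} {e′} h p with j , refl , ke≡e ← key ψ∈ e =
      sat-cong (kf j) (λ i → cong (m fr′) (trans (ke≡e i) (e≡e′ i)))
        (sound fr′ j inside′ (trans (sym τ≡) (complete fr j inside
          (sat-cong (kf j) (λ i → cong (m fr) (sym (ke≡e i))) p))))
      where
      e≡e′ : ∀ {x} → x ∈ fv (kf j) → e x ≡ e′ x
      e≡e′ i with p , p′ , eq ← h i = trans (sym (level-pt fr p)) (trans (cong level eq) (level-pt fr′ p′))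

      inside : Inside (X fr) j
      inside i = subst (In (X fr)) (sym (ke≡e i)) (proj₁ (h i))

      inside′ : Inside (X fr′) j
      inside′ i = subst (In (X fr′)) (sym (trans (ke≡e i) (e≡e′ i))) (proj₁ (proj₂ (h i)))

      τ≡ : τ (s fr) j ≡ τ (s fr′) j
      τ≡ = τ-cong λ {l} t → let x , i , eq = find t in
        same-bits fr fr′ (touch-inside {X fr} {j} inside t) (touch-inside {X fr′} {j} inside′ t)
          (trans (cong (pt fr) (trans (sym eq) (ke≡e i)))
            (trans (proj₂ (proj₂ (h i))) (cong (pt fr′) (trans (sym (trans (ke≡e i) (e≡e′ i))) eq))))

    frameAt : (v : Dom) → (Fin k → F) → Σ Frame λ fr → In (X fr) (level v) × pt fr (level v) ≡ v
    frameAt v s₀ with splitAt nc v in eq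
    ... | inj₁ i = record
      { X = [] ; s = s₀ ; m = _ ; good = Good-base s₀ ; pt = [ (λ _ → cst i₀) , cst ]′
      ; pt-cst = λ _ → refl ; pt-elt = λ () } , tt , splitAt⁻¹-↑ˡ eq
    ... | inj₂ d with s′ , m′ , g , e ← D-realised d = record
      { X = proj₁ (D d) ∷ [] ; s = s′ ; m = m′ ; good = g ; pt = [ (λ _ → elt d) , cst ]′
      ; pt-cst = λ _ → refl ; pt-elt = λ { (here refl) → d , refl , cong (proj₁ (D d) ,_) (sym e) } }
      , here refl , splitAt⁻¹-↑ʳ eq

    -- A frame may occupy all levels. Before the witnesses of a quantifier are added, the levels
    -- that its free variables do not use are released, so that fresh ones are available.
    restrict : ∀ fr {Y} → (∀ {l} → l ∈ Y → l ∈ X fr) → Frame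
    restrict fr {Y} h = record
      { X = Y ; s = s fr ; m = m fr ; good = Good-mono h (good fr) ; pt = pt fr
      ; pt-cst = pt-cst fr ; pt-elt = pt-elt fr ∘ h }

    extendFrame : ∀ fr {l a} → l ∉ X fr → (∀ {b} → In (X fr) b → m fr b ≢ a) →
      ¬ ¬ Σ Frame λ fr′ → X fr′ ≡ l ∷ X fr × m fr′ (inj₁ l) ≡ a
        × (∀ {b} → In (X fr) b → m fr′ b ≡ m fr b × pt fr′ b ≡ pt fr b)
    extendFrame fr {l} {a} l∉X new = do
      f , g ← extend (good fr) l∉X new
      -- The new pair belongs to the domain: the extended tuple, restricted to level `l`, realises
      -- it.
      let d , e = D-complete (l , f) (_ , _ , Good-mono (λ { (here refl) → here refl }) g , update-≡ _≟ᶠ_ l f (s fr))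
      return (record
        { X = l ∷ X fr ; s = _ ; m = _ ; good = g
        ; pt = [ update _≟ᶠ_ l (elt d) (pt fr ∘ inj₁) , cst ]′
        ; pt-cst = λ _ → refl
        ; pt-elt = λ
          { (here refl) → d , update-≡ _≟ᶠ_ l (elt d) _ , trans e (cong (l ,_) (sym (update-≡ _≟ᶠ_ l f (s fr))))
          ; (there i) → let d′ , p , r = pt-elt fr i in
              d′ , trans (update-≢ _≟ᶠ_ l (elt d) _ (old i)) p , trans r (cong (_ ,_) (sym (update-≢ _≟ᶠ_ l f (s fr) (old i)))) }
        } , refl , update-≡ _≟ᶠ_ l a _ , λ {b} i → updateLev-In (good fr) l∉X new {b} i , pt-old d {b} i)
      where
      old : ∀ {l′} → l′ ∈ X fr → l′ ≢ l
      old i refl = l∉X i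

      pt-old : ∀ d {b} → In (X fr) b → [ update _≟ᶠ_ l (elt d) (pt fr ∘ inj₁) , cst ]′ b ≡ pt fr b
      pt-old d {inj₁ l′} i = update-≢ _≟ᶠ_ l (elt d) _ (old i)
      pt-old d {inj₂ i}  _ = sym (pt-cst fr i)

    Covers : Frame → (ℕ → Lev) → (ℕ → Carrier) → List ℕ → Set
    Covers fr e μ W = ∀ {x} → x ∈ W → In (X fr) (e x) × m fr (e x) ≡ μ x

    -- If `μ x` is already copied in the frame, its level has to be reused, or the copying map would
    -- stop being injective. Otherwise a fresh level takes it. Either way at most one level is
    -- spent.
    cover₁ : ∀ x W fr e μ → suc (length (X fr)) ≤ k → Covers fr e μ W →
      ¬ ¬ Σ Frame λ fr′ → Σ (ℕ → Lev) λ e′ → length (X fr′) ≤ suc (length (X fr))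
        × Covers fr′ e′ μ (x ∷ W) × (∀ {y} → y ∈ W → pt fr′ (e′ y) ≡ pt fr (e y))
    cover₁ x W fr e μ bound cov with x ∈? W
    ... | yes i = return (fr , e , n≤1+n _ , (λ { {_} (here refl) → cov i ; {_} (there j) → cov j }) , λ {_} _ → refl)
    ... | no x∉W = ¬¬-excluded-middle {A = Σ Lev λ b → In (X fr) b × m fr b ≡ μ x} >>= λ where
        (yes (b , i , eq)) → return (fr , update _≟_ x b e , n≤1+n _
          , (λ { {_} (here refl) → subst (λ c → In (X fr) c × m fr c ≡ μ x) (sym (update-≡ _≟_ x b e)) (i , eq)
               ; {y} (there j) → subst (λ c → In (X fr) c × m fr c ≡ μ y) (sym (other b j)) (cov j) })
          , λ {_} j → cong (pt fr) (other b j))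
        (no none) → let l , l∉X = fresh (X fr) bound in
          extendFrame fr l∉X (λ {b} i eq → none (b , i , eq)) >>= λ where
            (fr′ , refl , ml , keep) → return (fr′ , update _≟_ x (inj₁ l) e , ≤-refl
              , (λ { {_} (here refl) → subst (λ c → In (X fr′) c × m fr′ c ≡ μ x) (sym (update-≡ _≟_ x (inj₁ l) e)) (here refl , ml)
                   ; {y} (there j) → subst (λ c → In (X fr′) c × m fr′ c ≡ μ y) (sym (other (inj₁ l) j))
                       (In-mono there (proj₁ (cov j)) , trans (proj₁ (keep (proj₁ (cov j)))) (proj₂ (cov j))) })
              , λ {_} j → trans (cong (pt fr′) (other (inj₁ l) j)) (proj₂ (keep (proj₁ (cov j)))))
      where
      other : ∀ b {y} → y ∈ W → update _≟_ x b e y ≡ e y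
      other b j = update-≢ _≟_ x b e λ { refl → x∉W j }

    cover : ∀ xs W fr e μ → length (X fr) + length xs ≤ k → Covers fr e μ W →
      ¬ ¬ Σ Frame λ fr′ → Σ (ℕ → Lev) λ e′ →
        Covers fr′ e′ μ (xs ++ W) × (∀ {y} → y ∈ W → pt fr′ (e′ y) ≡ pt fr (e y))
    cover []       W fr e μ bound cov = return (fr , e , (λ {_} → cov) , λ {_} _ → refl)
    cover (x ∷ xs) W fr e μ bound cov = do
      fr₁ , e₁ , b₁ , cov₁ , keep₁ ← cover₁ x W fr e μ
        (≤-trans (s≤s (m≤m+n _ (length xs))) (≤-trans (≤-reflexive (sym (+-suc _ _))) bound)) cov
      fr₂ , e₂ , cov₂ , keep₂ ← cover xs (x ∷ W) fr₁ e₁ μ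
        (≤-trans (+-monoˡ-≤ (length xs) b₁) (≤-trans (≤-reflexive (sym (+-suc _ _))) bound)) cov₁
      return (fr₂ , e₂ , (λ {_} i → cov₂ (shift i)) , λ {_} j → trans (keep₂ (there j)) (keep₁ j))
      where
      shift : ∀ {y} → y ∈ x ∷ xs ++ W → y ∈ xs ++ x ∷ W
      shift (here refl) = ∈-++⁺ʳ xs (here refl)
      shift (there i) with ∈-++⁻ xs i
      ... | inj₁ j = ∈-++⁺ˡ j
      ... | inj₂ j = ∈-++⁺ʳ xs (there j)

    RelN : ∀ R → Vec Dom (RelSym.arity R) → Set
    RelN R v = Σ Frame λ fr → Σ (Vec Lev (RelSym.arity R)) λ ls →
      AllV (In (X fr)) ls × Vec.map (pt fr) ls ≡ v × relI R (Vec.map (m fr) ls)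

    -- Levels are read off the elements themselves, so two frames that show the same elements use
    -- the same levels for them.
    align : ∀ fr fr′ {n} {ls ls′ : Vec Lev n} → AllV (In (X fr)) ls → AllV (In (X fr′)) ls′ →
      Vec.map (pt fr) ls ≡ Vec.map (pt fr′) ls′ →
      ls ≡ ls′ × AllV (λ a → In (X fr) a × In (X fr′) a × pt fr a ≡ pt fr′ a) ls
    align fr fr′ []ᵛ []ᵛ e = refl , []ᵛ
    align fr fr′ {ls = a ∷ _} {a′ ∷ _} (p ∷ᵛ ps) (p′ ∷ᵛ ps′) e with refl , qs ← align fr fr′ ps ps′ (∷-injectiveʳ e)
      with refl ← trans (sym (level-pt fr p)) (trans (cong level (∷-injectiveˡ e)) (level-pt fr′ p′))
      = refl , (p , p′ , ∷-injectiveˡ e) ∷ᵛ qs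

    open Coding (nc + q) (rels φ₀) (cons φ₀) using (Code; decode)

    -- Truth in the finite model equals truth in `M`, frame by frame.

    module Truth (cidx : ℕ → Fin nc) (cidx-correct : ∀ {c} → c ∈ cons φ₀ → crep (cidx c) ≡ conI c)
      (k-bound : len φ₀ ≤ k) (C : Code)
      (relN-correct : ∀ {R} → R ∈ rels φ₀ → ∀ v →
         (Structure.relI (decode C) R v → RelN R v) × (RelN R v → Structure.relI (decode C) R v))
      (conN-correct : ∀ {c} → c ∈ cons φ₀ → Structure.conI (decode C) c ≡ cst (cidx c))
      where

      N : Structure
      N = decode C

      module SN = Sem N
      module PN = SemProps N

      evalL : (ℕ → Lev) → Term → Lev
      evalL e (var x) = e x
      evalL e (con c) = inj₂ (cidx c)

      Known : List ℕ → Set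
      Known cs = ∀ {c} → c ∈ cs → c ∈ cons φ₀

      evalN : ∀ fr e t → Known (termCons t) → SN.evalT (pt fr ∘ e) t ≡ pt fr (evalL e t)
      evalN fr e (var x) h = refl
      evalN fr e (con c) h = trans (conN-correct (h (here refl))) (sym (pt-cst fr (cidx c)))

      evalM : ∀ fr e t → Known (termCons t) → evalT (m fr ∘ e) t ≡ m fr (evalL e t)
      evalM fr e (var x) h = refl
      evalM fr e (con c) h = trans (sym (cidx-correct (h (here refl)))) (sym (m-cst fr (cidx c)))

      evalNs : ∀ fr e {n} (ts : Vec Term n) → Known (concatMap termCons (toList ts)) →
        Vec.map (SN.evalT (pt fr ∘ e)) ts ≡ Vec.map (pt fr) (Vec.map (evalL e) ts)
      evalNs fr e []       h = refl
      evalNs fr e (t ∷ ts) h = cong₂ _∷_ (evalN fr e t (h ∘ ∈-++⁺ˡ)) (evalNs fr e ts (h ∘ ∈-++⁺ʳ (termCons t)))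

      evalMs : ∀ fr e {n} (ts : Vec Term n) → Known (concatMap termCons (toList ts)) →
        Vec.map (evalT (m fr ∘ e)) ts ≡ Vec.map (m fr) (Vec.map (evalL e) ts)
      evalMs fr e []       h = refl
      evalMs fr e (t ∷ ts) h = cong₂ _∷_ (evalM fr e t (h ∘ ∈-++⁺ˡ)) (evalMs fr e ts (h ∘ ∈-++⁺ʳ (termCons t)))

      evalL-In : ∀ {X} e t → (∀ {x} → x ∈ termVars t → In X (e x)) → In X (evalL e t)
      evalL-In e (var x) h = h (here refl)
      evalL-In e (con c) h = tt

      evalLs-In : ∀ {X} e {n} (ts : Vec Term n) → (∀ {x} → x ∈ concatMap termVars (toList ts) → In X (e x)) →
        AllV (In X) (Vec.map (evalL e) ts)
      evalLs-In e []       h = []ᵛ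
      evalLs-In e (t ∷ ts) h = evalL-In e t (h ∘ ∈-++⁺ˡ) ∷ᵛ evalLs-In e ts (h ∘ ∈-++⁺ʳ (termVars t))

      known : ∀ {a} → atom a ∈ subs φ₀ → Known (atomCons a)
      known {a} a∈ i = ∈-concatMap⁺ topCons (lose a∈ i)

      -- The frame and the environment are universally quantified because the induction passes from
      -- one frame to another at each quantifier.
      Claim : Formula → Set
      Claim ψ = ∀ fr e → (∀ {x} → x ∈ fv ψ → In (X fr) (e x)) →
        (SN.sat (pt fr ∘ e) ψ → sat (m fr ∘ e) ψ) × (sat (m fr ∘ e) ψ → SN.sat (pt fr ∘ e) ψ)

      claim-atom : ∀ a → atom a ∈ subs φ₀ → Claim (atom a)
      claim-atom (rel R ts) a∈ fr e ins = to , from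
        where
        R∈ : R ∈ rels φ₀
        R∈ = ∈-concatMap⁺ topRels (lose a∈ (here refl))

        ls = Vec.map (evalL e) ts
        ls-In = evalLs-In e ts ins

        to : SN.sat (pt fr ∘ e) (atom (rel R ts)) → sat (m fr ∘ e) (atom (rel R ts))
        to p = sat-stable (atom (rel R ts)) do
          r ← p
          let fr′ , ls′ , ls′-In , eq , r′ = proj₁ (relN-correct R∈ _) r
              ls≡ , agree = align fr fr′ ls-In ls′-In (trans (sym (evalNs fr e ts (known a∈))) (sym eq))
          -- The fact may have been put there by another frame `fr′`, with another copy in `M`. The
          -- atom is itself a key, so its truth moves from that copy to the copy of `fr`.
          return (transfer a∈ fr′ fr
            (λ i → let p , p′ , e≡ = All-vars (evalL e) ts agree i in p′ , p , sym e≡)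
            (return (subst (relI R) (trans (cong (Vec.map (m fr′)) (sym ls≡)) (sym (evalMs fr′ e ts (known a∈)))) r′)))

        from : sat (m fr ∘ e) (atom (rel R ts)) → SN.sat (pt fr ∘ e) (atom (rel R ts))
        from p = do
          r ← p
          return (proj₂ (relN-correct R∈ _)
            (fr , ls , ls-In , sym (evalNs fr e ts (known a∈)) , subst (relI R) (evalMs fr e ts (known a∈)) r))
      claim-atom (eqA t u) a∈ fr e ins = to , from
        where
        kt : Known (termCons t)
        kt i = known a∈ (∈-++⁺ˡ i)
        ku : Known (termCons u)
        ku i = known a∈ (∈-++⁺ʳ (termCons t) i)
        it = evalL-In e t (ins ∘ ∈-++⁺ˡ)
        iu = evalL-In e u (ins ∘ ∈-++⁺ʳ (termVars t))

        to : SN.sat (pt fr ∘ e) (atom (eqA t u)) → sat (m fr ∘ e) (atom (eqA t u))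
        to p = do
          eq ← p
          -- Equal elements have equal levels and hence equal copies; the converse rests on the
          -- injectivity of `m`.
          let eq′ = trans (sym (evalN fr e t kt)) (trans eq (evalN fr e u ku))
              l≡ = trans (sym (level-pt fr it)) (trans (cong level eq′) (level-pt fr iu))
          return (trans (evalM fr e t kt) (trans (cong (m fr) l≡) (sym (evalM fr e u ku))))

        from : sat (m fr ∘ e) (atom (eqA t u)) → SN.sat (pt fr ∘ e) (atom (eqA t u))
        from p = do
          eq ← p
          let l≡ = m-inj fr it iu (trans (sym (evalM fr e t kt)) (trans eq (evalM fr e u ku)))
          return (trans (evalN fr e t kt) (trans (cong (pt fr) l≡) (sym (evalN fr e u ku))))

      Framed : Frame → Dom → Set
      Framed fr v = In (X fr) (level v) × pt fr (level v) ≡ v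

      -- Here guardedness enters. A relation holds in the model only of tuples that lie in one
      -- frame, and an equality guard forces all its variables to be the same element, for which
      -- `frameAt` supplies a frame.
      guardFrame : ∀ γ → atom γ ∈ subs φ₀ → ∀ ν → SN.satA ν γ →
        ¬ ¬ Σ Frame λ fr → ∀ {x} → x ∈ atomVars γ → Framed fr (ν x)
      guardFrame (rel R ts) γ∈ ν g = do
        r ← g
        let fr , ls , ls-In , eq , _ = proj₁ (relN-correct (∈-concatMap⁺ topRels (lose γ∈ (here refl))) _) r
        return (fr , λ {x} → All-vars (SN.evalT ν) ts (subst (AllV (Framed fr)) eq (framed fr ls-In)))
        where
        framed : ∀ fr {n} {ls : Vec Lev n} → AllV (In (X fr)) ls → AllV (Framed fr) (Vec.map (pt fr) ls)
        framed fr []ᵛ = []ᵛ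
        framed fr (p ∷ᵛ ps) = (subst (In (X fr)) (sym (level-pt fr p)) p , cong (pt fr) (level-pt fr p)) ∷ᵛ framed fr ps
      guardFrame (eqA t u) γ∈ ν g = do
        eq ← g
        let fr , p = frameAt (SN.evalT ν t) (λ _ → mkF λ _ → false)
        return (fr , λ {x} i → subst (Framed fr) (same eq i) p)
        where
        value : ∀ t {x} → x ∈ termVars t → SN.evalT ν t ≡ ν x
        value (var _) (here refl) = refl

        same : SN.evalT ν t ≡ SN.evalT ν u → ∀ {x} → x ∈ atomVars (eqA t u) → SN.evalT ν t ≡ ν x
        same eq i with ∈-++⁻ (termVars t) i
        ... | inj₁ j = value t j
        ... | inj₂ j = trans eq (value u j)

      -- A witness in the model lies in a frame given by the guard; there the existential formula
      -- holds in the copy, and it is transferred back to `fr` along the elements of its free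
      -- variables. Conversely, a witness in `M` is copied onto fresh levels. `Transfer` is a
      -- hypothesis because the universal case applies the lemma to a formula that need not be a
      -- subformula of `φ₀` and so need not have keys.
      claim-∃ : ∀ xs γ ψ → atom γ ∈ subs φ₀ → Claim (atom γ) → Claim ψ →
        (∀ {x} → x ∈ fv ψ → x ∈ atomVars γ) →
        length (fv (∃' xs (atom γ ∧' ψ))) + length xs ≤ k →
        Transfer (∃' xs (atom γ ∧' ψ)) → Claim (∃' xs (atom γ ∧' ψ))
      claim-∃ xs γ ψ γ∈ claimγ claimψ guarded bound tr fr e ins = to , from
        where
        χ = atom γ ∧' ψ

        fvχ : ∀ {x} → x ∈ fv χ → x ∈ atomVars γ
        fvχ i = [ id , guarded ]′ (∈-++⁻ (atomVars γ) i)

        to : SN.sat (pt fr ∘ e) (∃' xs χ) → sat (m fr ∘ e) (∃' xs χ)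
        to p = sat-stable (∃' xs χ) do
          ν , off , g , q ← PN.exQ-elim xs p
          fr′ , framed ← guardFrame γ γ∈ ν g
          let e′ = level ∘ ν
              at : ∀ {x} → x ∈ atomVars γ → ν x ≡ pt fr′ (e′ x)
              at i = sym (proj₂ (framed i))
              g′ = proj₁ (claimγ fr′ e′ (proj₁ ∘ framed)) (PN.sat-cong (atom γ) at g)
              q′ = proj₁ (claimψ fr′ e′ (proj₁ ∘ framed ∘ guarded)) (PN.sat-cong ψ (at ∘ guarded) q)
          return (tr fr′ fr
            (λ {x} i → let j , x∉ = ∈-filter⁻ (λ y → ¬? (y ∈? xs)) {xs = fv χ} i in
              proj₁ (framed (fvχ j)) , ins i , trans (proj₂ (framed (fvχ j))) (off x∉))
            (exQ-intro xs (m fr′ ∘ e′) (sat-cong χ {m fr′ ∘ e′} (λ _ → sym (updAll-agree xs refl)) (g′ , q′))))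

        W = fv (∃' xs χ)
        fr₀ = restrict fr {levels e W} (levels-⊆ e W ins)

        from : sat (m fr ∘ e) (∃' xs χ) → SN.sat (pt fr ∘ e) (∃' xs χ)
        from p = PN.sat-stable (∃' xs χ) do
          μ , off , g , q ← exQ-elim xs p
          fr′ , e′ , cov , keep ← cover xs W fr₀ e μ
            (≤-trans (+-monoˡ-≤ (length xs) (length-levels e W)) bound)
            (λ i → In-levels e i , sym (off (proj₂ (∈-filter⁻ (λ y → ¬? (y ∈? xs)) {xs = fv χ} i))))
          let covχ : Covers fr′ e′ μ (fv χ)
              covχ = λ i → cov (split i)
              inγ : Covers fr′ e′ μ (atomVars γ)
              inγ = λ i → covχ (∈-++⁺ˡ i)
              inψ : Covers fr′ e′ μ (fv ψ)
              inψ = λ i → covχ (∈-++⁺ʳ (atomVars γ) i)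
              g′ = proj₂ (claimγ fr′ e′ (proj₁ ∘ inγ)) (sat-cong (atom γ) (λ i → sym (proj₂ (inγ i))) g)
              q′ = proj₂ (claimψ fr′ e′ (proj₁ ∘ inψ)) (sat-cong ψ (λ i → sym (proj₂ (inψ i))) q)
          return (PN.exQ-intro xs (pt fr′ ∘ e′) (PN.sat-cong χ {pt fr′ ∘ e′} (agree fr′ e′ keep) (g′ , q′)))
          where
          split : ∀ {x} → x ∈ fv χ → x ∈ xs ++ W
          split {x} i with x ∈? xs
          ... | yes j = ∈-++⁺ˡ j
          ... | no nj = ∈-++⁺ʳ xs (∈-filter⁺ (λ y → ¬? (y ∈? xs)) i nj)

          agree : ∀ fr′ e′ → (∀ {y} → y ∈ W → pt fr′ (e′ y) ≡ pt fr (e y)) →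
            ∀ {x} → x ∈ fv χ → pt fr′ (e′ x) ≡ PN.updAll (pt fr ∘ e) xs (pt fr′ ∘ e′) x
          agree fr′ e′ keep {x} i with x ∈? xs
          ... | yes j = sym (PN.updAll-∈ j)
          ... | no nj = trans (keep (∈-filter⁺ (λ y → ¬? (y ∈? xs)) i nj)) (sym (PN.updAll-∉ xs nj))

      claim-¬ : ∀ {ψ} → Claim ψ → Claim (¬' ψ)
      claim-¬ c fr e ins = (λ p q → p (proj₂ (c fr e ins) q)) , (λ p q → p (proj₁ (c fr e ins) q))

      -- This is why `len φ₀` levels suffice: old elements are needed only for the free variables
      -- and new ones only for `xs`, and the length of the quantified formula pays for both.
      quantifier-bound : ∀ xs χ → suc (length xs + len χ) ≤ len φ₀ →
        length (fv (∃' xs χ)) + length xs ≤ k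
      quantifier-bound xs χ h = begin
        length (fv (∃' xs χ)) + length xs ≤⟨ +-monoˡ-≤ (length xs) (≤-trans (length-filter _ (fv χ)) (length-fv χ)) ⟩
        len χ + length xs                 ≡⟨ +-comm (len χ) (length xs) ⟩
        length xs + len χ                 ≤⟨ n≤1+n _ ⟩
        suc (length xs + len χ)           ≤⟨ ≤-trans h k-bound ⟩
        k                                 ∎
        where open ≤-Reasoning

      claim : ∀ ψ → GF ψ → (∀ {χ} → χ ∈ subs ψ → χ ∈ subs φ₀) → Claim ψ
      claim (atom a) gf sub = claim-atom a (sub (here refl))
      claim (¬' φ) (gneg gf) sub = claim-¬ {φ} (claim φ gf (sub ∘ there))
      claim (φ ∧' ψ) (gand gf gf′) sub fr e ins =
          (λ (p , q) → proj₁ c p , proj₁ d q) , (λ (p , q) → proj₂ c p , proj₂ d q)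
        where
        c = claim φ gf (sub ∘ there ∘ ∈-++⁺ˡ) fr e (ins ∘ ∈-++⁺ˡ)
        d = claim ψ gf′ (sub ∘ there ∘ ∈-++⁺ʳ (subs φ)) fr e (ins ∘ ∈-++⁺ʳ (fv φ))
      claim (φ ∨' ψ) (gor gf gf′) sub fr e ins =
          (λ h (p , q) → h (p ∘ proj₁ c , q ∘ proj₁ d)) , (λ h (p , q) → h (p ∘ proj₂ c , q ∘ proj₂ d))
        where
        c = claim φ gf (sub ∘ there ∘ ∈-++⁺ˡ) fr e (ins ∘ ∈-++⁺ˡ)
        d = claim ψ gf′ (sub ∘ there ∘ ∈-++⁺ʳ (subs φ)) fr e (ins ∘ ∈-++⁺ʳ (fv φ))
      claim (φ ⇒' ψ) (gimp gf gf′) sub fr e ins =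
          (λ h p → proj₁ d (h (proj₂ c p))) , (λ h p → proj₂ d (h (proj₁ c p)))
        where
        c = claim φ gf (sub ∘ there ∘ ∈-++⁺ˡ) fr e (ins ∘ ∈-++⁺ˡ)
        d = claim ψ gf′ (sub ∘ there ∘ ∈-++⁺ʳ (subs φ)) fr e (ins ∘ ∈-++⁺ʳ (fv φ))
      claim (φ ⇔' ψ) (giff gf gf′) sub fr e ins =
          (λ (h , h′) → (λ p → proj₁ d (h (proj₂ c p))) , (λ p → proj₁ c (h′ (proj₂ d p))))
        , (λ (h , h′) → (λ p → proj₂ d (h (proj₁ c p))) , (λ p → proj₂ c (h′ (proj₁ d p))))
        where
        c = claim φ gf (sub ∘ there ∘ ∈-++⁺ˡ) fr e (ins ∘ ∈-++⁺ˡ)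
        d = claim ψ gf′ (sub ∘ there ∘ ∈-++⁺ʳ (subs φ)) fr e (ins ∘ ∈-++⁺ʳ (fv φ))
      claim (∃' xs (atom γ ∧' ψ)) (gex xs γ gf _ guarded) sub =
        claim-∃ xs γ ψ (sub (there (there (here refl)))) (claim-atom γ (sub (there (there (here refl)))))
          (claim ψ gf (sub ∘ there ∘ there ∘ there)) (All.lookup guarded)
          (quantifier-bound xs (atom γ ∧' ψ) (len-subs φ₀ (sub (here refl))))
          (transfer (sub (here refl)))
      claim (∀' xs (atom γ ⇒' ψ)) (gall xs γ gf _ guarded) sub fr e ins =
          (λ h → ∃¬⇒∀ (∀⇒∃¬N h ∘ proj₂ c)) , (λ h → ∃¬⇒∀N (∀⇒∃¬ h ∘ proj₁ c))
        where
        ∀⇒∃¬ : ∀ {ρ} → sat ρ (∀' xs (atom γ ⇒' ψ)) → ¬ sat ρ (∃' xs (atom γ ∧' ¬' ψ))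
        ∀⇒∃¬ = allQ⇒¬exQ xs λ _ h (g , n) → n (h g)

        ∃¬⇒∀ : ∀ {ρ} → ¬ sat ρ (∃' xs (atom γ ∧' ¬' ψ)) → sat ρ (∀' xs (atom γ ⇒' ψ))
        ∃¬⇒∀ = ¬exQ⇒allQ xs λ _ h g → sat-stable ψ λ n → h (g , n)

        ∀⇒∃¬N : ∀ {ρ} → SN.sat ρ (∀' xs (atom γ ⇒' ψ)) → ¬ SN.sat ρ (∃' xs (atom γ ∧' ¬' ψ))
        ∀⇒∃¬N = PN.allQ⇒¬exQ xs λ _ h (g , n) → n (h g)

        ∃¬⇒∀N : ∀ {ρ} → ¬ SN.sat ρ (∃' xs (atom γ ∧' ¬' ψ)) → SN.sat ρ (∀' xs (atom γ ⇒' ψ))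
        ∃¬⇒∀N = PN.¬exQ⇒allQ xs λ _ h g → PN.sat-stable ψ λ n → h (g , n)

        -- The keys cover the universal subformula and not this dual of its negation. Its transfer
        -- is the contrapositive of the transfer of the universal formula, with the two frames
        -- exchanged.
        transfer∃ : Transfer (∃' xs (atom γ ∧' ¬' ψ))
        transfer∃ fr fr′ {e} {e′} joint p = sat-stable (∃' xs (atom γ ∧' ¬' ψ)) λ n →
          ∀⇒∃¬ (transfer (sub (here refl)) fr′ fr {e′} {e}
            (λ i → let a , b , eq = joint i in b , a , sym eq) (∃¬⇒∀ n)) p

        c = claim-∃ xs γ (¬' ψ) (sub (there (there (here refl)))) (claim-atom γ (sub (there (there (here refl)))))
          (claim-¬ {ψ} (claim ψ gf (sub ∘ there ∘ there ∘ there))) (All.lookup guarded)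
          -- `atom γ ⇒' ψ` and `atom γ ∧' ¬' ψ` have the same free variables, so the bound is taken
          -- from the subformula that actually occurs.
          (quantifier-bound xs (atom γ ⇒' ψ) (len-subs φ₀ (sub (here refl))))
          transfer∃ fr e ins

-- Enumerating constants, elements and keys, and assembling the finite model.

representatives : ∀ {A : Set} (xs : List A) → ¬ ¬ Σ ℕ λ n → n ≤ length xs × Σ (Fin n → A) λ r →
  (∀ {i j} → r i ≡ r j → i ≡ j) × (∀ {x} → x ∈ xs → Σ (Fin n) λ i → r i ≡ x)
representatives [] = return (0 , z≤n , (λ ()) , (λ {i} → λ { {()} }) , λ {_} ())
representatives (x ∷ xs) = do
  n , n≤ , r , inj , rep ← representatives xs
  ¬¬-excluded-middle {A = Σ (Fin n) λ i → r i ≡ x} >>= λ where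
    (yes p) → return (n , m≤n⇒m≤1+n n≤ , r , (λ {_} {_} → inj) , λ { {_} (here refl) → p ; {_} (there i) → rep i })
    (no np) → return (suc n , s≤s n≤ , (λ { zero → x ; (suc i) → r i })
      , (λ { {zero} {zero} _ → refl ; {zero} {suc j} e → contradiction (j , sym e) np
           ; {suc i} {zero} e → contradiction (i , e) np ; {suc i} {suc j} e → cong suc (inj e) })
      , λ { {_} (here refl) → zero , refl ; {_} (there i) → let j , e = rep i in suc j , e })

-- Being realised refers to `M` and comes without a decision procedure; the realised pairs can still
-- be enumerated under a double negation.
¬¬-filter : ∀ n (P : Fin n → Set) → ¬ ¬ Σ ℕ λ q → q ≤ n × Σ (Fin q → Fin n) λ D →
  (∀ d → P (D d)) × (∀ i → P i → Σ (Fin q) λ d → D d ≡ i)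
¬¬-filter zero    P = return (0 , z≤n , (λ ()) , (λ ()) , λ ())
¬¬-filter (suc n) P = do
  q , q≤ , D , D-P , D-all ← ¬¬-filter n (P ∘ suc)
  ¬¬-excluded-middle {A = P zero} >>= λ where
    (yes p) → return (suc q , s≤s q≤ , (λ { zero → zero ; (suc d) → suc (D d) })
      , (λ { zero → p ; (suc d) → D-P d })
      , λ { zero _ → zero , refl ; (suc i) r → let d , e = D-all i r in suc d , cong suc e })
    (no np) → return (q , m≤n⇒m≤1+n q≤ , suc ∘ D , D-P
      , λ { zero r → contradiction r np ; (suc i) r → let d , e = D-all i r in d , cong suc e })

module _ {A : Set} (default : A) where

  -- Lists of free variables may contain repetitions. The first occurrence is read, and
  -- `restrictEnv` writes the same value at every occurrence, so repetitions are harmless.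
  listEnv : List ℕ → ∀ {n} → (Fin n → A) → ℕ → A
  listEnv []       g x = default
  listEnv (y ∷ ys) {zero}  g x = default
  listEnv (y ∷ ys) {suc n} g x with x ≟ y
  ... | yes _ = g zero
  ... | no _  = listEnv ys (g ∘ suc) x

  restrictEnv : List ℕ → ∀ {n} → (ℕ → A) → Fin n → A
  restrictEnv []       e i       = default
  restrictEnv (y ∷ ys) e zero    = e y
  restrictEnv (y ∷ ys) e (suc i) = restrictEnv ys e i

  listEnv-restrictEnv : ∀ ys {n} {g : Fin n → A} {e} → length ys ≤ n → (∀ i → g i ≡ restrictEnv ys e i) →
    ∀ {x} → x ∈ ys → listEnv ys g x ≡ e x
  listEnv-restrictEnv (y ∷ ys) {suc n} (s≤s h) eq {x} i with x ≟ y
  ... | yes refl = eq zero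
  ... | no ne with i
  ...   | here e  = contradiction e ne
  ...   | there j = listEnv-restrictEnv ys h (eq ∘ suc) j

fromBool : Bool → Fin 2
fromBool false = zero
fromBool true  = suc zero

toBool : Fin 2 → Bool
toBool zero    = false
toBool (suc _) = true

toBool-fromBool : ∀ b → toBool (fromBool b) ≡ b
toBool-fromBool false = refl
toBool-fromBool true  = refl

-- At most n subformulas, and n slots for the values of free variables. A slot holds one of n levels
-- or one of at most n + 1 constant values, namely those of the constants of the formula and one
-- more for `elem`.
keyCount : ℕ → ℕ
keyCount n = n * (n + suc n) ^ n

sizeBound : ℕ → ℕ
sizeBound n = suc n + n * 2 ^ keyCount n

module _ (M : Structure) (φ₀ : Formula) (gf : GF φ₀) (sentence : Sentence φ₀) (M⊨φ₀ : M ⊨ φ₀) where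
  open Structure M

  private
    n : ℕ
    n = len φ₀

  module Keys (nc : ℕ) (i₀ : Fin nc) where

    Lev : Set
    Lev = Fin n ⊎ Fin nc

    K : ℕ
    K = length (subs φ₀) * (n + nc) ^ n

    keyFormula : Fin (length (subs φ₀)) × Fin ((n + nc) ^ n) → Formula
    keyFormula (i , _) = List.lookup (subs φ₀) i

    keyEnv : Fin (length (subs φ₀)) × Fin ((n + nc) ^ n) → ℕ → Lev
    keyEnv (i , r) = listEnv (inj₂ i₀) (fv (List.lookup (subs φ₀) i)) {n} (splitAt n ∘ finToFun {n + nc} {n} r)

    kf : Fin K → Formula
    kf j = keyFormula (remQuot ((n + nc) ^ n) j)

    ke : Fin K → ℕ → Lev
    ke j = keyEnv (remQuot ((n + nc) ^ n) j)

    key : ∀ {ψ} → ψ ∈ subs φ₀ → (e : ℕ → Lev) → Σ (Fin K) λ j → kf j ≡ ψ × (∀ {x} → x ∈ fv ψ → ke j x ≡ e x)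
    key {ψ} ψ∈ e = combine (index ψ∈) r , trans (cong keyFormula pair) (sym (lookup-index ψ∈)) , λ {x} i →
      trans (cong (λ p → keyEnv p x) pair) (listEnv-restrictEnv (inj₂ i₀) (fv (List.lookup (subs φ₀) (index ψ∈)))
        (≤-trans (length-fv ψ′) (len-subs φ₀ ψ′∈))
        (λ l → trans (cong (splitAt n) (finToFun-funToFin g l)) (splitAt-join n nc (restrictEnv (inj₂ i₀) (fv ψ′) e l)))
        (subst (λ χ → x ∈ fv χ) (lookup-index ψ∈) i))
      where
      ψ′ = List.lookup (subs φ₀) (index ψ∈)
      ψ′∈ : ψ′ ∈ subs φ₀
      ψ′∈ = subst (_∈ subs φ₀) (lookup-index ψ∈) ψ∈
      g : Fin n → Fin (n + nc)
      g = join n nc ∘ restrictEnv (inj₂ i₀) (fv ψ′) e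
      r : Fin ((n + nc) ^ n)
      r = funToFin g
      pair = remQuot-combine (index ψ∈) r

  FiniteModel : ℕ → Set
  FiniteModel m = Σ (Coding.Code m (rels φ₀) (cons φ₀)) λ C → Coding.decode m (rels φ₀) (cons φ₀) C ⊨ φ₀

  closed : ∀ {x} → x ∉ fv φ₀
  closed i rewrite sentence = contradiction i λ ()

  bound : ∀ nc q → nc ≤ suc (length (List.map conI (cons φ₀))) →
    q ≤ n * 2 ^ (length (subs φ₀) * (n + nc) ^ n) → nc + q ≤ sizeBound n
  bound nc q nc≤ q≤ = +-mono-≤ nc≤′
    (≤-trans q≤ (*-monoʳ-≤ n (^-monoʳ-≤ 2 (*-mono-≤ (length-subs φ₀) (^-monoˡ-≤ n (+-monoʳ-≤ n nc≤′))))))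
    where
    nc≤′ : nc ≤ suc n
    nc≤′ = ≤-trans nc≤ (s≤s (≤-trans (≤-reflexive (length-map conI (cons φ₀))) (length-cons φ₀)))

  module Construction (nc : ℕ) (i₀ : Fin nc)
    (crep : Fin nc → Carrier) (crep-injective : ∀ {i j} → crep i ≡ crep j → i ≡ j)
    (rep : ∀ {c} → c ∈ cons φ₀ → Σ (Fin nc) λ i → crep i ≡ conI c)
    (truth : ∀ j → Dec (Sem.sat M ([ (λ _ → elem) , crep ]′ ∘ Keys.ke nc i₀ j) (Keys.kf nc i₀ j))) where
    open Keys nc i₀

    cidx? : ∀ {c} → Dec (c ∈ cons φ₀) → Fin nc
    cidx? (yes i) = proj₁ (rep i)
    cidx? (no _)  = i₀

    cidx?-correct : ∀ {c} (i? : Dec (c ∈ cons φ₀)) → c ∈ cons φ₀ → crep (cidx? i?) ≡ conI c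
    cidx?-correct (yes i) _ = proj₂ (rep i)
    cidx?-correct (no ni) i = contradiction i ni

    cidx : ℕ → Fin nc
    cidx c = cidx? (c ∈? cons φ₀)

    cidx-correct : ∀ {c} → c ∈ cons φ₀ → crep (cidx c) ≡ conI c
    cidx-correct {c} = cidx?-correct (c ∈? cons φ₀)

    F : Set
    F = Fin (2 ^ K)

    bit : F → Fin K → Bool
    bit f j = toBool (finToFun {2} {K} f j)

    mkF : (Fin K → Bool) → F
    mkF g = funToFin (fromBool ∘ g)

    bit-mkF : ∀ g j → bit (mkF g) j ≡ g j
    bit-mkF g j = trans (cong toBool (finToFun-funToFin (fromBool ∘ g) j)) (toBool-fromBool (g j))

    β : Fin K → Bool
    β j = does (truth j)

    does-correct : ∀ {P : Set} (p? : Dec P) → (does p? ≡ true → P) × (P → does p? ≡ true)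
    does-correct (yes p) = (λ _ → p) , λ _ → refl
    does-correct (no np) = (λ ()) , λ p → contradiction p np

    β-correct : ∀ j → (β j ≡ true → Sem.sat M ([ (λ _ → elem) , crep ]′ ∘ ke j) (kf j))
      × (Sem.sat M ([ (λ _ → elem) , crep ]′ ∘ ke j) (kf j) → β j ≡ true)
    β-correct j = does-correct (truth j)

    open Amalgamation M φ₀ n nc K crep crep-injective kf ke key F bit mkF bit-mkF β β-correct public
      using (Realised; module Model)

    module Elements (q : ℕ) (D : Fin q → Fin (n * 2 ^ K)) (D-realised : ∀ d → Realised (remQuot (2 ^ K) (D d)))
      (D-all : ∀ b → Realised (remQuot (2 ^ K) b) → Σ (Fin q) λ d → D d ≡ b) where

      element : Fin q → Fin n × F
      element d = remQuot (2 ^ K) (D d)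

      element-complete : ∀ y → Realised y → Σ (Fin q) λ d → element d ≡ y
      element-complete (l , f) r = let d , e = D-all (combine l f) (subst Realised (sym (remQuot-combine l f)) r) in
        d , trans (cong (remQuot (2 ^ K)) e) (remQuot-combine l f)

      open Model q element i₀ D-realised element-complete

      model : ¬ ¬ FiniteModel (nc + q)
      model = do
        C , relN-correct , conN-correct ← Coding.realise (nc + q) (rels φ₀) (cons φ₀) RelN (cst i₀) (cst ∘ cidx)
        let T⊨φ₀ = proj₂ (Truth.claim cidx cidx-correct ≤-refl C relN-correct conN-correct φ₀ gf id
                     (proj₁ (frameAt (cst i₀) (λ _ → mkF λ _ → false))) (λ _ → inj₂ i₀) (λ i → contradiction i closed))
                     (SemProps.sat-cong M φ₀ (λ i → contradiction i closed) M⊨φ₀)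
        return (C , SemProps.sat-cong (Coding.decode (nc + q) (rels φ₀) (cons φ₀) C) φ₀ (λ i → contradiction i closed) T⊨φ₀)

  finiteModel : ¬ ¬ Σ ℕ λ m → m ≤ sizeBound n × FiniteModel m
  finiteModel = do
    -- `elem` is added so that there is at least one representative, the default `i₀`, even for a
    -- formula without constants.
    nc , nc≤ , crep , crep-inj , rep ← representatives (elem ∷ List.map conI (cons φ₀))
    let i₀ = proj₁ (rep (here refl))
        repᶜ : ∀ {c} → c ∈ cons φ₀ → Σ (Fin nc) λ i → crep i ≡ conI c
        repᶜ = λ i → rep (there (∈-map⁺ conI i))
    truth ← ¬¬-∀Fin (Keys.K nc i₀) λ j →
      ¬¬-excluded-middle {A = Sem.sat M ([ (λ _ → elem) , crep ]′ ∘ Keys.ke nc i₀ j) (Keys.kf nc i₀ j)}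
    q , q≤ , D , D-realised , D-all ← ¬¬-filter _
      (Construction.Realised nc i₀ crep crep-inj repᶜ truth ∘ remQuot (2 ^ Keys.K nc i₀))
    C ← Construction.Elements.model nc i₀ crep crep-inj repᶜ truth q D D-realised D-all
    return (nc + q , bound nc q nc≤ q≤ , C)

  boundedModel : Σ ℕ λ m → m ≤ sizeBound n × FiniteModel m
  boundedModel = let i , C = decidable-stable search λ none → finiteModel λ (m , m≤ , C) →
                       none (fromℕ< (s≤s m≤) , subst FiniteModel (sym (toℕ-fromℕ< (s≤s m≤))) C)
                 in toℕ i , s≤s⁻¹ (toℕ<n i) , C
    where
    search : Dec (Σ (Fin (suc (sizeBound n))) λ i → FiniteModel (toℕ i))
    search = any? λ i → Coding.model? (toℕ i) (rels φ₀) (cons φ₀) φ₀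

-- Arithmetic of the upper bound.

3≤len : ∀ φ → 3 ≤ len φ
3≤len (atom (rel R ts)) = m≤m+n 3 _
3≤len (atom (eqA s t))  = ≤-refl
3≤len (¬' φ)    = m≤n⇒m≤1+n (3≤len φ)
3≤len (φ ∧' ψ)  = s≤s (s≤s (s≤s z≤n))
3≤len (φ ∨' ψ)  = s≤s (s≤s (s≤s z≤n))
3≤len (φ ⇒' ψ)  = s≤s (s≤s (s≤s z≤n))
3≤len (φ ⇔' ψ)  = s≤s (s≤s (s≤s z≤n))
3≤len (∃' xs φ) = ≤-trans (3≤len φ) (m≤n+m _ (1 + length xs))
3≤len (∀' xs φ) = ≤-trans (3≤len φ) (m≤n+m _ (1 + length xs))

n<2^n : ∀ n → suc n ≤ 2 ^ n
n<2^n zero    = s≤s z≤n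
n<2^n (suc n) = begin
  suc (suc n)           ≤⟨ s≤s (n<2^n n) ⟩
  1 + 2 ^ n             ≤⟨ +-monoˡ-≤ (2 ^ n) (m^n>0 2 n) ⟩
  2 ^ n + 2 ^ n         ≡⟨ cong (2 ^ n +_) (+-identityʳ (2 ^ n)) ⟨
  2 ^ suc n             ∎
  where open ≤-Reasoning

module _ (n : ℕ) (3≤n : 3 ≤ n) where
  open ≤-Reasoning

  private instance
    n≢0 : NonZero n
    n≢0 = >-nonZero (≤-trans (s≤s z≤n) 3≤n)

  keyCount-≤ : keyCount n ≤ n ^ (1 + 2 * n)
  keyCount-≤ = begin
    n * (n + suc n) ^ n   ≤⟨ *-monoʳ-≤ n (^-monoˡ-≤ n base) ⟩
    n * (n ^ 2) ^ n       ≡⟨ cong (n *_) (^-*-assoc n 2 n) ⟩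
    n * n ^ (2 * n)       ∎
    where
    base : n + suc n ≤ n ^ 2
    base = begin
      n + suc n             ≡⟨ +-suc n n ⟩
      1 + (n + n)           ≤⟨ +-monoˡ-≤ (n + n) (≤-trans (s≤s z≤n) 3≤n) ⟩
      n + (n + n)           ≡⟨ cong (λ x → n + (n + x)) (+-identityʳ n) ⟨
      3 * n                 ≤⟨ *-monoˡ-≤ n 3≤n ⟩
      n * n                 ≡⟨ cong (n *_) (*-identityʳ n) ⟨
      n ^ 2                 ∎

  -- The origin of the constant 3: from 2n + 1 ≤ n^2 there are at most n^(1+2n) keys, the remaining
  -- terms at most triple this exponent, and n ≥ 3 absorbs the factor 3 into n^(2+2n) ≤ n^(3n).
  sizeBound-≤ : sizeBound n ≤ 2 ^ (n ^ (3 * n))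
  sizeBound-≤ = begin
    suc n + n * 2 ^ K               ≤⟨ +-mono-≤ (n<2^n n) (*-monoˡ-≤ (2 ^ K) (<⇒≤ (n<2^n n))) ⟩
    2 ^ n + 2 ^ n * 2 ^ K           ≤⟨ +-monoˡ-≤ _ (m≤m*n (2 ^ n) (2 ^ K) {{m^n≢0 2 K}}) ⟩
    2 ^ n * 2 ^ K + 2 ^ n * 2 ^ K   ≡⟨ cong (λ x → x + x) (^-distribˡ-+-* 2 n K) ⟨
    2 ^ (n + K) + 2 ^ (n + K)       ≡⟨ cong (2 ^ (n + K) +_) (+-identityʳ _) ⟨
    2 ^ suc (n + K)                 ≤⟨ ^-monoʳ-≤ 2 exponent ⟩
    2 ^ (n ^ (3 * n))               ∎
    where
    K = keyCount n
    E = n ^ (1 + 2 * n)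

    n≤E : n ≤ E
    n≤E = m≤m*n n (n ^ (2 * n)) {{m^n≢0 n (2 * n)}}

    exponent : suc (n + K) ≤ n ^ (3 * n)
    exponent = begin
      suc (n + K)         ≤⟨ s≤s (+-mono-≤ n≤E keyCount-≤) ⟩
      1 + (E + E)         ≤⟨ +-monoˡ-≤ (E + E) (≤-trans (≤-trans (s≤s z≤n) 3≤n) n≤E) ⟩
      E + (E + E)         ≡⟨ cong (λ x → E + (E + x)) (+-identityʳ E) ⟨
      3 * E               ≤⟨ *-monoˡ-≤ E 3≤n ⟩
      n ^ (2 + 2 * n)     ≤⟨ ^-monoʳ-≤ n (+-monoˡ-≤ (2 * n) (≤-trans (n≤1+n 2) 3≤n)) ⟩
      n ^ (3 * n)         ∎

-- With T = n^(p n), an a above T b would give m^b ≤ 2^(T b) ≤ 2^a, against the hypothesis on a and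
-- b.
DExpAtMost-intro : ∀ p n {m} → m ≤ 2 ^ (n ^ (p * n)) → DExpAtMost′ p 1 n m
DExpAtMost-intro p n {m} h a b 1≤b lt = begin
  a ^ 1                   ≡⟨ ^-identityʳ a ⟩
  a                       ≤⟨ ≮⇒≥ (λ T*b<a → <⇒≱ lt (≤-trans power (^-monoʳ-≤ 2 (<⇒≤ T*b<a)))) ⟩
  n ^ (p * n) * b         ≡⟨ *-comm _ b ⟩
  b * n ^ (p * n)         ≡⟨ cong (_* n ^ (p * n)) (^-identityʳ b) ⟨
  b ^ 1 * n ^ (p * n)     ∎
  where
  open ≤-Reasoning
  power : m ^ b ≤ 2 ^ (n ^ (p * n) * b)
  power = ≤-trans (^-monoˡ-≤ b h) (≤-reflexive (^-*-assoc 2 (n ^ (p * n)) b))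

-- Lower bound: rotations, pushes and reachability of all words.

module LowerBound where

  open import Data.Nat using (_<_)

  rot : ∀ {A : Set} {n} → Vec A (suc n) → Vec A (suc n)
  rot (a ∷ v) = v ∷ʳ a

  push : ∀ {A : Set} {n} → Vec A (suc n) → A → Vec A (suc n)
  push (_ ∷ v) c = v ∷ʳ c

  toList-inj : ∀ {A : Set} {n} {u v : Vec A n} → toList u ≡ toList v → u ≡ v
  toList-inj {u = []}    {[]}    e = refl
  toList-inj {u = a ∷ u} {b ∷ v} e = cong₂ _∷_ (headL e) (toList-inj (tailL e))

  module _ {A : Set} {n : ℕ} where

    -- Splitting a tuple as `as ++ bs` and swapping the parts changes the form of its length; on
    -- lists such tuples can be compared directly.
    Listed : (Vec A n → Set) → List A → Set
    Listed R xs = Σ (Vec A n) λ v → toList v ≡ xs × R v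

    unlist : ∀ {R v} → Listed R (toList v) → R v
    unlist {R} (v′ , e , r) = subst R (toList-inj e) r

  module _ {A : Set} {h : ℕ} where

    rotate : ∀ {R : Vec A (suc h) → Set} → (∀ {v} → R v → R (rot v)) →
      ∀ as {bs} → Listed R (as ++ bs) → Listed R (bs ++ as)
    rotate {R} step []       {bs} r = subst (Listed R) (sym (++-identityʳ bs)) r
    rotate {R} step (a ∷ as) {bs} (b ∷ v , e , r) = subst (Listed R) (++-assoc bs (a ∷ []) as)
      (rotate step as (v ∷ʳ b , trans (toList-∷ʳ b v) (trans (cong₂ (λ l c → l ++ c ∷ []) (tailL e) (headL e)) (++-assoc as bs _)) , step r))

    -- Each push drops one old letter from the front, so after `length as` pushes the prefix `as` is
    -- gone and `ts` stands at the end.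
    pushes : ∀ {R : Vec A (suc h) → Set} {z : List A} → (∀ {v c} → c ∈ z → R v → R (push v c)) →
      ∀ as ts {bs} → length as ≡ length ts → (∀ {t} → t ∈ ts → t ∈ z) → Listed R (as ++ bs) → Listed R (bs ++ ts)
    pushes {R} step []       []       {bs} l≡ sub r = subst (Listed R) (sym (++-identityʳ bs)) r
    pushes {R} step (a ∷ as) (t ∷ ts) {bs} l≡ sub (b ∷ v , e , r) = subst (Listed R) (++-assoc bs (t ∷ []) ts)
      (pushes step as ts (suc-injective l≡) (sub ∘ there)
        (v ∷ʳ t , trans (toList-∷ʳ t v) (trans (cong (_++ t ∷ []) (tailL e)) (++-assoc as bs _)) , step (sub (here refl)) r))

    -- Applied to the address `y` in `G`, to move it to any word, and to the word `w` in `H`, to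
    -- compare two nodes at every word.
    module Reach (Q : Vec A (suc h) → Vec A (suc h) → Set)
      (Q-rot : ∀ {z y} → Q z y → Q (rot z) y) (Q-push : ∀ {z y} → Q z y → Q z (push y (head z))) where

      -- Rotate `c` to the front, push it, and complete the rotation. The tuple `z` is restored, so
      -- words stay indexed by one fixed order of the letters.
      push-letter : ∀ {z y c} → c ∈ toList z → Q z y → Q z (push y c)
      push-letter {z} {y} {c} c∈ q with as , bs , eq ← ∈-∃++ c∈ = unlist
        (subst (Listed (λ z → Q z (push y c))) (sym eq) (rotate Q-rot (c ∷ bs) (pushed (rotate Q-rot as {c ∷ bs} (z , eq , q)))))
        where
        pushed : ∀ {l} → Listed (λ z → Q z y) (c ∷ l) → Listed (λ z → Q z (push y c)) (c ∷ l)
        pushed (b ∷ v , refl , q) = b ∷ v , refl , Q-push q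

      reach : ∀ {z y t} → (∀ {c} → c ∈ toList t → c ∈ toList z) → Q z y → Q z t
      reach {z} {y} {t} sub q = unlist (pushes {λ y → Q z y} {toList z} (λ c∈ → push-letter c∈) (toList y) (toList t)
        (trans (length-toList y) (sym (length-toList t))) sub
        (y , sym (++-identityʳ (toList y)) , q))
        where
        length-toList : ∀ {n} (v : Vec A n) → length (toList v) ≡ n
        length-toList []      = refl
        length-toList (_ ∷ v) = cong suc (length-toList v)

  lookup-injective : ∀ {A : Set} {n} (v : Vec A n) → (∀ as {c bs} → toList v ≡ as ++ c ∷ bs → c ∉ bs) →
    ∀ {i j} → lookup v i ≡ lookup v j → i ≡ j
  lookup-injective (a ∷ v) h {zero}  {zero}  e = refl
  lookup-injective (a ∷ v) h {zero}  {suc j} e =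
    contradiction (subst (_∈ toList v) (sym e) (VecMem.∈-toList⁺ (VecMem.∈-lookup j v))) (h [] refl)
  lookup-injective (a ∷ v) h {suc i} {zero}  e =
    contradiction (subst (_∈ toList v) e (VecMem.∈-toList⁺ (VecMem.∈-lookup i v))) (h [] refl)
  lookup-injective (a ∷ v) h {suc i} {suc j} e =
    cong suc (lookup-injective v (λ as eq → h (a ∷ as) (cong (a ∷_) eq)) e)

  finToFun-injective : ∀ {m n} {i j : Fin (m ^ n)} → (∀ l → finToFun {m} {n} i l ≡ finToFun j l) → i ≡ j
  finToFun-injective {m} {n} {i} {j} h =
    trans (sym (funToFin-finToFin {n} {m} i)) (trans (funToFin-cong h) (funToFin-finToFin {n} {m} j))
    where
    funToFin-cong : ∀ {n} {f g : Fin n → Fin m} → (∀ l → f l ≡ g l) → funToFin f ≡ funToFin g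
    funToFin-cong {zero}  e = refl
    funToFin-cong {suc n} e = cong₂ combine (e zero) (funToFin-cong (e ∘ suc))

  -- What the sentence says, freed from syntax. `G x z y`: node `x` with letters `z` currently
  -- points at address `y`. `H x z y x′ w`: node `x′` is to differ from `x` at `y` only, and `w` is
  -- the address under comparison. `P x w`: the bit of `x` at `w`.
  record FlipSystem (C : Set) (h : ℕ) : Set₁ where
    Word : Set
    Word = Vec C (suc h)
    field
      G : C → Word → Word → Set
      H : C → Word → Word → C → Word → Set
      P : C → Word → Set
      P-stable : ∀ {x y} → ¬ ¬ P x y → P x y
      G-start  : ¬ ¬ Σ C λ x → Σ Word λ z → Σ Word λ y → G x z y
      G-rot    : ∀ {x z y} → G x z y → G x (rot z) y
      G-push   : ∀ {x z y} → G x z y → G x z (push y (head z))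
      G-fresh  : ∀ {x z y} → G x z y → head z ∉ toList (tail z)
      G-flip   : ∀ {x z y} → G x z y → ¬ ¬ Σ C λ x′ → H x z y x′ y × G x′ z y
      H-rot    : ∀ {x z y x′ w} → H x z y x′ w → H x (rot z) y x′ w
      H-push   : ∀ {x z y x′ w} → H x z y x′ w → H x z y x′ (push w (head z))
      H-same   : ∀ {x z y x′ w} → H x z y x′ w → y ≢ w → (P x w → P x′ w) × (P x′ w → P x w)
      H-differ : ∀ {x z y x′} → H x z y x′ y → ¬ ((P x y → P x′ y) × (P x′ y → P x y))

  -- All bit patterns occur.

  module Patterns {C : Set} {h : ℕ} (S : FlipSystem C h) where
    open FlipSystem S

    k : ℕ
    k = suc h

    module _ (z : Word) where

      -- `G-fresh` separates only the first letter from the rest; rotating each letter to the front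
      -- separates all of them.
      letter-injective : ∀ {x y} → G x z y → ∀ {i j} → lookup z i ≡ lookup z j → i ≡ j
      letter-injective {x} {y} g = lookup-injective z λ as {c} {bs} eq c∈ →
        fresh-head (rotate {R = λ z → G x z y} G-rot as (z , eq , g)) (∈-++⁺ˡ c∈)
        where
        fresh-head : ∀ {c l} → Listed (λ z → G x z y) (c ∷ l) → c ∉ l
        fresh-head (b ∷ v , refl , g) = G-fresh g

      letter : Fin (k ^ k) → Fin k → C
      letter t = lookup z ∘ finToFun t

      word : Fin (k ^ k) → Word
      word t = tabulate (letter t)

      word-letters : ∀ t {c} → c ∈ toList (word t) → c ∈ toList z
      word-letters t = letters (finToFun t)
        where
        letters : ∀ {n} (f : Fin n → Fin k) {c} → c ∈ toList (tabulate (lookup z ∘ f)) → c ∈ toList z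
        letters {suc n} f (here refl) = VecMem.∈-toList⁺ (VecMem.∈-lookup (f zero) z)
        letters {suc n} f (there i)   = letters (f ∘ suc) i

      word-injective : ∀ {x y} → G x z y → ∀ {t t′} → word t ≡ word t′ → t ≡ t′
      word-injective g {t} {t′} e = finToFun-injective λ i → letter-injective g
        (trans (sym (lookup∘tabulate (letter t) i)) (trans (cong (λ w → lookup w i) e) (lookup∘tabulate (letter t′) i)))

      Fits : (Fin (k ^ k) → Bool) → C → Fin (k ^ k) → Set
      Fits W x t = (W t ≡ true → P x (word t)) × (P x (word t) → W t ≡ true)

      -- The pointer is moved to `word a` before the flip. Afterwards the comparison word, which
      -- starts at `word a`, is pushed to each other word in turn; injectivity of `word` tells these
      -- apart from the flipped one.
      flip : ∀ {x y} → G x z y → ∀ a → ¬ ¬ Σ C λ x′ → G x′ z (word a)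
        × (∀ {t} → t ≢ a → (P x (word t) → P x′ (word t)) × (P x′ (word t) → P x (word t)))
        × ¬ ((P x (word a) → P x′ (word a)) × (P x′ (word a) → P x (word a)))
      flip {x} {y} g a = do
        x′ , hh , g′ ← G-flip (Reach.reach (G x) G-rot G-push {z} {y} {word a} (word-letters a) g)
        return (x′ , g′
          , (λ {t} ne → H-same (Reach.reach (λ z → H x z (word a) x′) H-rot H-push {z} {word a} {word t} (word-letters t) hh)
               λ e → ne (sym (word-injective g e)))
          , H-differ hh)

      -- Flipping the bits one address at a time reaches every pattern.
      pattern-below : ∀ W {x y} → G x z y → ∀ n → n ≤ k ^ k →
        ¬ ¬ Σ C λ x → (Σ Word λ y → G x z y) × (∀ t → toℕ t < n → Fits W x t)
      pattern-below W g zero    n≤ = return (_ , (_ , g) , λ _ ())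
      pattern-below W g (suc n) n≤ = do
        x , (y , g₁) , fits ← pattern-below W g n (≤-trans (n≤1+n n) n≤)
        x′ , g₂ , same , differ ← flip g₁ a
        P? ← ¬¬-excluded-middle {A = P x (word a)}
        let keep : Fits W x a → ∀ t → toℕ t < suc n → Fits W x t
            keep = λ f t lt → [ (λ lt′ → fits t lt′) , (λ e → subst (Fits W x) (sym (at t e)) f) ]′ (m≤n⇒m<n∨m≡n (s≤s⁻¹ lt))
            change : Fits W x′ a → ∀ t → toℕ t < suc n → Fits W x′ t
            change = λ f t lt → [ (λ lt′ → move (same (λ e → <⇒≢ lt′ (trans (cong toℕ e) toℕ-a))) (fits t lt′))
                                , (λ e → subst (Fits W x′) (sym (at t e)) f) ]′ (m≤n⇒m<n∨m≡n (s≤s⁻¹ lt))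
        return (choose P? (W a) refl g₁ g₂ differ keep change)
        where
        a : Fin (k ^ k)
        a = fromℕ< n≤

        toℕ-a : toℕ a ≡ n
        toℕ-a = toℕ-fromℕ< n≤

        at : ∀ t → toℕ t ≡ n → t ≡ a
        at t e = toℕ-injective (trans e (sym toℕ-a))

        move : ∀ {x x′ t} → (P x (word t) → P x′ (word t)) × (P x′ (word t) → P x (word t)) → Fits W x t → Fits W x′ t
        move (f , f′) (p , q) = f ∘ p , q ∘ f′

        choose : ∀ {x x′ y} → Dec (P x (word a)) → ∀ b → W a ≡ b → G x z y → G x′ z (word a) →
          ¬ ((P x (word a) → P x′ (word a)) × (P x′ (word a) → P x (word a))) →
          (Fits W x a → ∀ t → toℕ t < suc n → Fits W x t) →
          (Fits W x′ a → ∀ t → toℕ t < suc n → Fits W x′ t) →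
          Σ C λ x → (Σ Word λ y → G x z y) × (∀ t → toℕ t < suc n → Fits W x t)
        choose (yes p) true  e g₁ g₂ differ keep change = _ , (_ , g₁) , keep ((λ _ → p) , λ _ → e)
        choose (no np) false e g₁ g₂ differ keep change = _ , (_ , g₁) ,
          keep ((λ e′ → contradiction (trans (sym e) e′) λ ()) , λ p → contradiction p np)
        choose (yes p) false e g₁ g₂ differ keep change = _ , (_ , g₂) ,
          change ((λ e′ → contradiction (trans (sym e) e′) λ ()) , λ p′ → contradiction ((λ _ → p′) , λ _ → p) differ)
        -- That the two bits differ refutes only the negation of `P` at `x′`, so stability of `P` is
        -- called for.
        choose (no np) true  e g₁ g₂ differ keep change = _ , (_ , g₂) ,
          change ((λ _ → P-stable λ np′ → differ ((λ p → contradiction p np) , λ p′ → contradiction p′ np′)) , λ _ → e)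

      pattern-exists : ∀ W {x y} → G x z y → ¬ ¬ Σ C λ x → ∀ t → Fits W x t
      pattern-exists W g = do
        x , _ , fits ← pattern-below W g (k ^ k) ≤-refl
        return (x , λ t → fits t (toℕ<n t))

    -- One node is chosen for each pattern under a double negation, which the decidable inequality
    -- then discharges. A node determines its pattern, so the choice is injective.
    size-≥ : ∀ {m} (f : C → Fin m) → (∀ {x y} → f x ≡ f y → x ≡ y) → 2 ^ (k ^ k) ≤ m
    size-≥ {m} f f-inj = decidable-stable (_ ≤? m) do
      x , z , y , g ← G-start
      node ← ¬¬-∀Fin (2 ^ (k ^ k)) λ W → pattern-exists z (toBool ∘ finToFun {2} {k ^ k} W) g
      return (injective⇒≤ {f = f ∘ proj₁ ∘ node} λ {W} {W′} e →
        finToFun-injective {2} {k ^ k} λ t → agree {z} {W} {W′} (f-inj e) (proj₂ (node W) t) (proj₂ (node W′) t))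
      where
      bit≡ : ∀ {b c : Fin 2} → (toBool b ≡ true → toBool c ≡ true) → (toBool c ≡ true → toBool b ≡ true) → b ≡ c
      bit≡ {zero}     {zero}     p q = refl
      bit≡ {zero}     {suc zero} p q = contradiction (q refl) λ ()
      bit≡ {suc zero} {zero}     p q = contradiction (p refl) λ ()
      bit≡ {suc zero} {suc zero} p q = refl

      agree : ∀ {z W W′ x x′ t} → x ≡ x′ → Fits z (toBool ∘ finToFun {2} {k ^ k} W) x t →
        Fits z (toBool ∘ finToFun {2} {k ^ k} W′) x′ t → finToFun {2} {k ^ k} W t ≡ finToFun {2} {k ^ k} W′ t
      agree refl (p , q) (p′ , q′) = bit≡ (q′ ∘ p) (q ∘ p′)

  -- The sentence: syntax, length and guardedness.

  block : ℕ → ∀ n → Vec Term n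
  block o zero    = []
  block o (suc n) = var o ∷ block (suc o) n

  block-++ : ∀ o m n → block o (m + n) ≡ block o m ++ᵛ block (o + m) n
  block-++ o zero    n = cong (λ p → block p n) (sym (+-identityʳ o))
  block-++ o (suc m) n = cong (var o ∷_) (trans (block-++ (suc o) m n) (cong (λ p → block (suc o) m ++ᵛ block p n) (sym (+-suc o m))))

  tvars : ∀ {n} → Vec Term n → List ℕ
  tvars ts = concatMap termVars (toList ts)

  ∈-block : ∀ o {n i} → o ≤ i → i < o + n → i ∈ tvars (block o n)
  ∈-block o {zero}  {i} o≤i i< = contradiction (subst (i <_) (+-identityʳ o) i<) (≤⇒≯ o≤i)
  ∈-block o {suc n} {i} o≤i i< with m≤n⇒m<n∨m≡n o≤i
  ... | inj₁ o<i  = there (∈-block (suc o) o<i (subst (i <_) (+-suc o n) i<))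
  ... | inj₂ refl = here refl

  ∈-tvars-++⁺ˡ : ∀ {m n} (ts : Vec Term m) {us : Vec Term n} {i} → i ∈ tvars ts → i ∈ tvars (ts ++ᵛ us)
  ∈-tvars-++⁺ˡ (var x ∷ ts) (here refl) = here refl
  ∈-tvars-++⁺ˡ (var x ∷ ts) (there j)   = there (∈-tvars-++⁺ˡ ts j)
  ∈-tvars-++⁺ˡ (con c ∷ ts) j           = ∈-tvars-++⁺ˡ ts j

  ∈-tvars-++⁺ʳ : ∀ {m n} (ts : Vec Term m) {us : Vec Term n} {i} → i ∈ tvars us → i ∈ tvars (ts ++ᵛ us)
  ∈-tvars-++⁺ʳ []           j = j
  ∈-tvars-++⁺ʳ (var x ∷ ts) j = there (∈-tvars-++⁺ʳ ts j)
  ∈-tvars-++⁺ʳ (con c ∷ ts) j = ∈-tvars-++⁺ʳ ts j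

  module _ (P : ℕ → Set) where

    Vars : List ℕ → Set
    Vars xs = ∀ {i} → i ∈ xs → P i

    Vars-++ : ∀ xs {ys} → Vars xs → Vars ys → Vars (xs ++ ys)
    Vars-++ xs p q i = [ p , q ]′ (∈-++⁻ xs i)

    Vars-++ᵛ : ∀ {m n} (ts : Vec Term m) {us : Vec Term n} → Vars (tvars ts) → Vars (tvars us) → Vars (tvars (ts ++ᵛ us))
    Vars-++ᵛ []           p q i           = q i
    Vars-++ᵛ (var x ∷ ts) p q (here refl) = p (here refl)
    Vars-++ᵛ (var x ∷ ts) p q (there i)   = Vars-++ᵛ ts (p ∘ there) q i
    Vars-++ᵛ (con c ∷ ts) p q i           = Vars-++ᵛ ts p q i

    Vars-∷ʳ : ∀ {m} (ts : Vec Term m) {u} → Vars (tvars ts) → Vars (termVars u) → Vars (tvars (ts ∷ʳ u))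
    Vars-∷ʳ []           {var x} p q (here refl) = q (here refl)
    Vars-∷ʳ (var x ∷ ts) p q (here refl) = p (here refl)
    Vars-∷ʳ (var x ∷ ts) p q (there i)   = Vars-∷ʳ ts (p ∘ there) q i
    Vars-∷ʳ (con c ∷ ts) p q i           = Vars-∷ʳ ts p q i

  block-< : ∀ o n {A} → o + n ≤ A → Vars (_< A) (tvars (block o n))
  block-< o (suc n) o+n≤ (here refl) = ≤-trans (s≤s (m≤m+n o n)) (≤-trans (≤-reflexive (sym (+-suc o n))) o+n≤)
  block-< o (suc n) o+n≤ (there i)   = block-< (suc o) n (≤-trans (≤-reflexive (sym (+-suc o n))) o+n≤) i

  distinct : ∀ {n} → Term → Vec Term n → Formula
  distinct t []       = atom (eqA t t)
  distinct t (u ∷ us) = ¬' (atom (eqA t u)) ∧' distinct t us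

  equal : ∀ {n} → Vec Term n → Vec Term n → Formula
  -- A trivially true equation ends the conjunction; variable 0 stands for the node and occurs in
  -- the guard.
  equal []       []       = atom (eqA (var 0) (var 0))
  equal (t ∷ ts) (u ∷ us) = atom (eqA t u) ∧' equal ts us

  distinct-Vars : ∀ {P n t} (us : Vec Term n) → Vars P (termVars t) → Vars P (tvars us) → Vars P (fv (distinct t us))
  distinct-Vars {P} {t = t} []       p q = Vars-++ P (termVars t) p p
  distinct-Vars {P} {t = t} (u ∷ us) p q = Vars-++ P (termVars t ++ termVars u)
    (Vars-++ P (termVars t) p (q ∘ ∈-++⁺ˡ)) (distinct-Vars us p (q ∘ ∈-++⁺ʳ (termVars u)))

  equal-Vars : ∀ {P n} (ts us : Vec Term n) → P 0 → Vars P (tvars ts) → Vars P (tvars us) → Vars P (fv (equal ts us))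
  equal-Vars []       []       o p q (here refl) = o
  equal-Vars []       []       o p q (there (here refl)) = o
  equal-Vars {P} (t ∷ ts) (u ∷ us) o p q = Vars-++ P (termVars t ++ termVars u)
    (Vars-++ P (termVars t) (p ∘ ∈-++⁺ˡ) (q ∘ ∈-++⁺ˡ))
    (equal-Vars ts us o (p ∘ ∈-++⁺ʳ (termVars t)) (q ∘ ∈-++⁺ʳ (termVars u)))

  distinct-GF : ∀ {n} t (us : Vec Term n) → GF (distinct t us)
  distinct-GF t []       = gatom _
  distinct-GF t (u ∷ us) = gand (gneg (gatom _)) (distinct-GF t us)

  equal-GF : ∀ {n} (ts us : Vec Term n) → GF (equal ts us)
  equal-GF []       []       = gatom _
  equal-GF (t ∷ ts) (u ∷ us) = gand (gatom _) (equal-GF ts us)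

  distinct-len : ∀ {n} t (us : Vec Term n) → len (distinct t us) ≡ 3 + n * 7
  distinct-len t []       = refl
  distinct-len t (u ∷ us) = cong (7 +_) (distinct-len t us)

  equal-len : ∀ {n} (ts us : Vec Term n) → len (equal ts us) ≡ 3 + n * 6
  equal-len []       []       = refl
  equal-len (t ∷ ts) (u ∷ us) = cong (6 +_) (equal-len ts us)

  closed-fv : ∀ xs φ → Vars (_∈ xs) (fv φ) → fv (∃' xs φ) ≡ []
  closed-fv xs φ h = filter-none (λ y → ¬? (y ∈? xs)) {fv φ} (All.tabulate λ i n → n (h i))

  -- The variables are numbered in the order x, z, y, x′, w, in which they appear in `guardH`. So
  -- both guards list an initial segment of the variables, and `upTo` quantifies over exactly these.
  module Flip (h : ℕ) where

    k gA hA : ℕ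
    k  = suc h
    gA = suc (k + k)
    hA = suc (k + (k + suc k))

    Gₛ Hₛ Pₛ : RelSym
    Gₛ = rsym 0 gA
    Hₛ = rsym 1 hA
    Pₛ = rsym 2 (suc k)

    Gₐ : Term → Vec Term k → Vec Term k → Atom
    Gₐ x z y = rel Gₛ (x ∷ z ++ᵛ y)

    Hₐ : Term → Vec Term k → Vec Term k → Term → Vec Term k → Atom
    Hₐ x z y x′ w = rel Hₛ (x ∷ z ++ᵛ (y ++ᵛ (x′ ∷ w)))

    Pₐ : Term → Vec Term k → Atom
    Pₐ x w = rel Pₛ (x ∷ w)

    xᵥ x′ᵥ : Term
    xᵥ  = var 0
    x′ᵥ = var (1 + k + k)

    zᵥ yᵥ wᵥ : Vec Term k
    zᵥ = block 1 k
    yᵥ = block (1 + k) k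
    wᵥ = block (2 + k + k) k

    guardG guardH : Atom
    guardG = Gₐ xᵥ zᵥ yᵥ
    guardH = Hₐ xᵥ zᵥ yᵥ x′ᵥ wᵥ

    flipᶠ bodyG bodyH start stepG stepH φ : Formula
    -- The comparison starts with w = y, the one address at which the two nodes have to differ.
    flipᶠ = ∃' (1 + k + k ∷ []) (atom (Hₐ xᵥ zᵥ yᵥ x′ᵥ yᵥ) ∧' atom (Gₐ x′ᵥ zᵥ yᵥ))
    bodyG = atom (Gₐ xᵥ (rot zᵥ) yᵥ)
      ∧' (atom (Gₐ xᵥ zᵥ (push yᵥ (head zᵥ)))
      -- Only `h` inequalities are written; the closure under rotation spreads them to all pairs and
      -- the length stays linear.
      ∧' (distinct (head zᵥ) (tail zᵥ)
      ∧' flipᶠ))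
    bodyH = atom (Hₐ xᵥ (rot zᵥ) yᵥ x′ᵥ wᵥ)
      ∧' (atom (Hₐ xᵥ zᵥ yᵥ x′ᵥ (push wᵥ (head zᵥ)))
      ∧' (equal yᵥ wᵥ ⇔' ¬' (atom (Pₐ xᵥ wᵥ) ⇔' atom (Pₐ x′ᵥ wᵥ))))
    -- A guarded quantifier needs a body besides its guard, so the guard is repeated.
    start = ∃' (upTo gA) (atom guardG ∧' atom guardG)
    stepG = ∀' (upTo gA) (atom guardG ⇒' bodyG)
    stepH = ∀' (upTo hA) (atom guardH ⇒' bodyH)
    φ = start ∧' (stepG ∧' stepH)

    φ-len : len φ ≡ 146 + 46 * h
    φ-len = begin
      total (length (upTo gA)) (length (upTo hA)) (len (distinct (head zᵥ) (tail zᵥ))) (len (equal yᵥ wᵥ)) gA hA k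
        ≡⟨ cong₂ (λ a b → total a b (len (distinct (head zᵥ) (tail zᵥ))) (len (equal yᵥ wᵥ)) gA hA k) (length-upTo gA) (length-upTo hA) ⟩
      total gA hA (len (distinct (head zᵥ) (tail zᵥ))) (len (equal yᵥ wᵥ)) gA hA k
        ≡⟨ cong₂ (λ d e → total gA hA d e gA hA k) (distinct-len (head zᵥ) (tail zᵥ)) (equal-len yᵥ wᵥ) ⟩
      total gA hA (3 + h * 7) (3 + k * 6) gA hA k
        ≡⟨ arithmetic h ⟩
      146 + 46 * h ∎
      where
      open ≡-Reasoning

      total : (a b d e g u k : ℕ) → ℕ
      total a b d e g u k =
        3 + (1 + a + (3 + (3 + g) + (3 + g)))
          + (3 + (1 + a + (3 + (3 + g) + (3 + (3 + g) + (3 + (3 + g) + (3 + d + (2 + (3 + (3 + u) + (3 + g))))))))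
               + (1 + b + (3 + (3 + u) + (3 + (3 + u) + (3 + (3 + u) + (3 + e + (1 + (3 + (3 + (1 + k)) + (3 + (1 + k))))))))))

      arithmetic : ∀ h → let k = 1 + h; g = 1 + (k + k); u = 1 + (k + (k + (1 + k))) in
        3 + (1 + g + (3 + (3 + g) + (3 + g)))
          + (3 + (1 + g + (3 + (3 + g) + (3 + (3 + g) + (3 + (3 + g) + (3 + (3 + h * 7) + (2 + (3 + (3 + u) + (3 + g))))))))
               + (1 + u + (3 + (3 + u) + (3 + (3 + u) + (3 + (3 + u) + (3 + (3 + k * 6) + (1 + (3 + (3 + (1 + k)) + (3 + (1 + k)))))))))) ≡ 146 + 46 * h
      arithmetic = solve-∀

    guardG≡ : block 0 gA ≡ xᵥ ∷ zᵥ ++ᵛ yᵥ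
    guardG≡ = cong (var 0 ∷_) (block-++ 1 k k)

    guardH≡ : block 0 hA ≡ xᵥ ∷ zᵥ ++ᵛ (yᵥ ++ᵛ (x′ᵥ ∷ wᵥ))
    guardH≡ = cong (var 0 ∷_) (trans (block-++ 1 k (k + suc k)) (cong (zᵥ ++ᵛ_) (block-++ (1 + k) k (suc k))))

    ∈-guardG : ∀ {i} → i < gA → i ∈ atomVars guardG
    ∈-guardG {i} i< = subst (λ ts → i ∈ tvars ts) guardG≡ (∈-block 0 z≤n i<)

    ∈-guardH : ∀ {i} → i < hA → i ∈ atomVars guardH
    ∈-guardH {i} i< = subst (λ ts → i ∈ tvars ts) guardH≡ (∈-block 0 z≤n i<)

    guardG-< : Vars (_< gA) (atomVars guardG)
    guardG-< = subst (λ ts → Vars (_< gA) (tvars ts)) guardG≡ (block-< 0 gA ≤-refl)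

    guardH-< : Vars (_< hA) (atomVars guardH)
    guardH-< = subst (λ ts → Vars (_< hA) (tvars ts)) guardH≡ (block-< 0 hA ≤-refl)

    Vars-G : ∀ {P x z y} → Vars P (termVars x) → Vars P (tvars z) → Vars P (tvars y) → Vars P (atomVars (Gₐ x z y))
    Vars-G {P} {x} {z} p q r = Vars-++ P (termVars x) p (Vars-++ᵛ P z q r)

    Vars-H : ∀ {P x z y x′ w} → Vars P (termVars x) → Vars P (tvars z) → Vars P (tvars y) →
      Vars P (termVars x′) → Vars P (tvars w) → Vars P (atomVars (Hₐ x z y x′ w))
    Vars-H {P} {x} {z} {y} {x′} p q r s t =
      Vars-++ P (termVars x) p (Vars-++ᵛ P z q (Vars-++ᵛ P y r (Vars-++ P (termVars x′) s t)))

    module Bounds {A : ℕ} (gA≤A : gA ≤ A) where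
      x< : Vars (_< A) (termVars xᵥ)
      x< (here refl) = ≤-trans (s≤s z≤n) gA≤A
      z< : Vars (_< A) (tvars zᵥ)
      z< = block-< 1 k (≤-trans (s≤s (m≤m+n k k)) gA≤A)
      z₁< : Vars (_< A) (termVars (head zᵥ))
      z₁< (here refl) = z< (here refl)
      rot-z< : Vars (_< A) (tvars (rot zᵥ))
      rot-z< = Vars-∷ʳ (_< A) (tail zᵥ) (z< ∘ there) z₁<
      y< : Vars (_< A) (tvars yᵥ)
      y< = block-< (1 + k) k gA≤A

    bodyG-< : Vars (_< gA) (fv bodyG)
    bodyG-< = Vars-++ (_< gA) (atomVars (Gₐ xᵥ (rot zᵥ) yᵥ)) (Vars-G {x = xᵥ} {z = rot zᵥ} x< rot-z< y<)
      (Vars-++ (_< gA) (atomVars (Gₐ xᵥ zᵥ (push yᵥ (head zᵥ))))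
        (Vars-G {x = xᵥ} {z = zᵥ} x< z< (Vars-∷ʳ (_< gA) (tail yᵥ) (y< ∘ there) z₁<))
        (Vars-++ (_< gA) (fv (distinct (head zᵥ) (tail zᵥ))) (distinct-Vars (tail zᵥ) z₁< (z< ∘ there)) flip<))
      where
      open Bounds {gA} ≤-refl
      module B′ = Bounds {suc gA} (n≤1+n gA)
      x′< : Vars (_< suc gA) (termVars x′ᵥ)
      x′< (here refl) = ≤-refl
      flip< : Vars (_< gA) (fv flipᶠ)
      -- The variables of the body lie below `suc gA`, and the bound variable x′ is exactly the
      -- index `gA`.
      flip< i with j , ne ← ∈-filter⁻ (λ y → ¬? (y ∈? (1 + k + k ∷ []))) {xs = fv (atom (Hₐ xᵥ zᵥ yᵥ x′ᵥ yᵥ) ∧' atom (Gₐ x′ᵥ zᵥ yᵥ))} i =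
        ≤∧≢⇒< (s≤s⁻¹ (Vars-++ (_< suc gA) (atomVars (Hₐ xᵥ zᵥ yᵥ x′ᵥ yᵥ))
            (Vars-H {x = xᵥ} {z = zᵥ} {y = yᵥ} {x′ = x′ᵥ} B′.x< B′.z< B′.y< x′< B′.y<)
            (Vars-G {x = x′ᵥ} {z = zᵥ} x′< B′.z< B′.y<) j))
          (λ e → ne (here e))

    bodyH-< : Vars (_< hA) (fv bodyH)
    bodyH-< = Vars-++ (_< hA) (atomVars (Hₐ xᵥ (rot zᵥ) yᵥ x′ᵥ wᵥ))
      (Vars-H {x = xᵥ} {z = rot zᵥ} {y = yᵥ} {x′ = x′ᵥ} x< rot-z< y< x′< w<)
      (Vars-++ (_< hA) (atomVars (Hₐ xᵥ zᵥ yᵥ x′ᵥ (push wᵥ (head zᵥ))))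
        (Vars-H {x = xᵥ} {z = zᵥ} {y = yᵥ} {x′ = x′ᵥ} x< z< y< x′< (Vars-∷ʳ (_< hA) (tail wᵥ) (w< ∘ there) z₁<))
        (Vars-++ (_< hA) (fv (equal yᵥ wᵥ)) (equal-Vars yᵥ wᵥ (s≤s z≤n) y< w<)
          (Vars-++ (_< hA) (atomVars (Pₐ xᵥ wᵥ)) (Vars-++ (_< hA) (termVars xᵥ) x< w<)
            (Vars-++ (_< hA) (termVars x′ᵥ) x′< w<))))
      where
      hA≡ : 2 + k + k + k ≡ hA
      hA≡ = cong suc (trans (cong suc (+-assoc k k k)) (trans (sym (+-suc k (k + k))) (cong (k +_) (sym (+-suc k k)))))
      open Bounds {hA} (s≤s (+-monoʳ-≤ k (m≤m+n k (suc k))))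
      w< : Vars (_< hA) (tvars wᵥ)
      w< = block-< (2 + k + k) k (≤-reflexive hA≡)
      x′< : Vars (_< hA) (termVars x′ᵥ)
      x′< (here refl) = ≤-trans (m≤m+n (2 + k + k) k) (≤-reflexive hA≡)

    φ-GF : GF φ
    φ-GF = gand (gex (upTo gA) guardG (gatom _) upToG (All.tabulate id))
      (gand (gall (upTo gA) guardG
               (gand (gatom _) (gand (gatom _) (gand (distinct-GF _ (tail zᵥ)) (gex _ _ (gatom _) (x′∈ ∷ []) (All.tabulate G⊆H)))))
               upToG (All.tabulate (∈-guardG ∘ bodyG-<)))
            (gall (upTo hA) guardH
               (gand (gatom _) (gand (gatom _) (giff (equal-GF yᵥ wᵥ) (gneg (giff (gatom _) (gatom _))))))
               (All.tabulate (∈-guardH ∘ ∈-upTo⁻)) (All.tabulate (∈-guardH ∘ bodyH-<))))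
      where
      upToG : All (_∈ atomVars guardG) (upTo gA)
      upToG = All.tabulate (∈-guardG ∘ ∈-upTo⁻)

      x′∈ : 1 + k + k ∈ atomVars (Hₐ xᵥ zᵥ yᵥ x′ᵥ yᵥ)
      x′∈ = there (∈-tvars-++⁺ʳ zᵥ (∈-tvars-++⁺ʳ yᵥ (here refl)))

      G⊆H : Vars (_∈ atomVars (Hₐ xᵥ zᵥ yᵥ x′ᵥ yᵥ)) (atomVars (Gₐ x′ᵥ zᵥ yᵥ))
      G⊆H = Vars-G {x = x′ᵥ} {z = zᵥ} (λ { (here refl) → x′∈ }) (λ i → there (∈-tvars-++⁺ˡ zᵥ i))
        (λ i → there (∈-tvars-++⁺ʳ zᵥ (∈-tvars-++⁺ˡ yᵥ i)))

    stepG-Vars : Vars (_∈ upTo gA) (fv (atom guardG ⇒' bodyG))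
    stepG-Vars = Vars-++ (_∈ upTo gA) (atomVars guardG) (∈-upTo⁺ ∘ guardG-<) (∈-upTo⁺ ∘ bodyG-<)

    stepH-Vars : Vars (_∈ upTo hA) (fv (atom guardH ⇒' bodyH))
    stepH-Vars = Vars-++ (_∈ upTo hA) (atomVars guardH) (∈-upTo⁺ ∘ guardH-<) (∈-upTo⁺ ∘ bodyH-<)

    φ-sentence : Sentence φ
    φ-sentence = cong₂ _++_
      (closed-fv (upTo gA) (atom guardG ∧' atom guardG)
        (Vars-++ (_∈ upTo gA) (atomVars guardG) (∈-upTo⁺ ∘ guardG-<) (∈-upTo⁺ ∘ guardG-<)))
      (cong₂ _++_ (closed-fv (upTo gA) (atom guardG ⇒' bodyG) stepG-Vars)
                  (closed-fv (upTo hA) (atom guardH ⇒' bodyH) stepH-Vars))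

  -- What the sentence means in a structure.

  map-rot : ∀ {A B : Set} {n} (f : A → B) (v : Vec A (suc n)) → Vec.map f (rot v) ≡ rot (Vec.map f v)
  map-rot f (a ∷ v) = map-∷ʳ f a v

  map-push : ∀ {A B : Set} {n} (f : A → B) (v : Vec A (suc n)) c → Vec.map f (push v c) ≡ push (Vec.map f v) (f c)
  map-push f (a ∷ v) c = map-∷ʳ f c v

  module FlipSemantics (h : ℕ) (M : Structure) where
    open Flip h
    open Structure M
    open Sem M
    open SemProps M

    Word : Set
    Word = Vec Carrier k

    G : Carrier → Word → Word → Set
    G x z y = ¬ ¬ relI Gₛ (x ∷ z ++ᵛ y)

    H : Carrier → Word → Word → Carrier → Word → Set
    H x z y x′ w = ¬ ¬ relI Hₛ (x ∷ z ++ᵛ (y ++ᵛ (x′ ∷ w)))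

    P : Carrier → Word → Set
    P x w = ¬ ¬ relI Pₛ (x ∷ w)

    BodyG : Carrier → Word → Word → Set
    BodyG x z y = G x (rot z) y × G x z (push y (head z)) × head z ∉ toList (tail z)
      × ¬ ¬ Σ Carrier λ x′ → H x z y x′ y × G x′ z y

    BodyH : Carrier → Word → Word → Carrier → Word → Set
    BodyH x z y x′ w = H x (rot z) y x′ w × H x z y x′ (push w (head z))
      × (¬ ¬ (y ≡ w) → ¬ ((P x w → P x′ w) × (P x′ w → P x w)))
      × (¬ ((P x w → P x′ w) × (P x′ w → P x w)) → ¬ ¬ (y ≡ w))

    ev : ∀ {n} → Env → Vec Term n → Vec Carrier n
    ev σ = Vec.map (evalT σ)

    satG : ∀ σ t zs ys → sat σ (atom (Gₐ t zs ys)) ≡ G (evalT σ t) (ev σ zs) (ev σ ys)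
    satG σ t zs ys = cong (λ v → ¬ ¬ relI Gₛ (evalT σ t ∷ v)) (map-++ (evalT σ) zs ys)

    satH : ∀ σ t zs ys t′ ws → sat σ (atom (Hₐ t zs ys t′ ws)) ≡ H (evalT σ t) (ev σ zs) (ev σ ys) (evalT σ t′) (ev σ ws)
    satH σ t zs ys t′ ws = cong (λ v → ¬ ¬ relI Hₛ (evalT σ t ∷ v))
      (trans (map-++ (evalT σ) zs _) (cong (ev σ zs ++ᵛ_) (map-++ (evalT σ) ys _)))

    distinct⇒ : ∀ {n} σ t (us : Vec Term n) → sat σ (distinct t us) → evalT σ t ∉ toList (ev σ us)
    distinct⇒ σ t (u ∷ us) (n , s) (here e)  = n (return e)
    distinct⇒ σ t (u ∷ us) (n , s) (there i) = distinct⇒ σ t us s i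

    distinct⇐ : ∀ {n} σ t (us : Vec Term n) → evalT σ t ∉ toList (ev σ us) → sat σ (distinct t us)
    distinct⇐ σ t []       n = return refl
    distinct⇐ σ t (u ∷ us) n = (λ e → e (n ∘ here)) , distinct⇐ σ t us (n ∘ there)

    equal⇒ : ∀ {n} σ (ts us : Vec Term n) → sat σ (equal ts us) → ¬ ¬ (ev σ ts ≡ ev σ us)
    equal⇒ σ []       []       s = return refl
    equal⇒ σ (t ∷ ts) (u ∷ us) (e , s) = do
      p ← e
      q ← equal⇒ σ ts us s
      return (cong₂ _∷_ p q)

    equal⇐ : ∀ {n} σ (ts us : Vec Term n) → ¬ ¬ (ev σ ts ≡ ev σ us) → sat σ (equal ts us)
    equal⇐ σ []       []       e = return refl
    equal⇐ σ (t ∷ ts) (u ∷ us) e = (λ n → e (n ∘ ∷-injectiveˡ)) , equal⇐ σ ts us (λ n → e (n ∘ ∷-injectiveʳ))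

    module _ (σ : Env) (d : Carrier) where
      private
        σ′ : Env
        σ′ = upd σ (1 + k + k) d

      ev-upd : ∀ {n} (ts : Vec Term n) → Vars (_< gA) (tvars ts) → ev σ′ ts ≡ ev σ ts
      ev-upd ts b = evalTs-cong ts λ i → upd-≢ σ (1 + k + k) d (<⇒≢ (b i))

      flip-body : sat σ′ (atom (Hₐ xᵥ zᵥ yᵥ x′ᵥ yᵥ) ∧' atom (Gₐ x′ᵥ zᵥ yᵥ))
        ≡ (H (evalT σ xᵥ) (ev σ zᵥ) (ev σ yᵥ) d (ev σ yᵥ) × G d (ev σ zᵥ) (ev σ yᵥ))
      flip-body = trans (cong₂ _×_ (satH σ′ xᵥ zᵥ yᵥ x′ᵥ yᵥ) (satG σ′ x′ᵥ zᵥ yᵥ))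
        (respect (ev-upd zᵥ (Bounds.z< ≤-refl)) (ev-upd yᵥ (Bounds.y< ≤-refl)) (upd-≡ σ (1 + k + k) d))
        where
        respect : ∀ {x z z₁ y y₁ c c₁} → z ≡ z₁ → y ≡ y₁ → c ≡ c₁ → (H x z y c y × G c z y) ≡ (H x z₁ y₁ c₁ y₁ × G c₁ z₁ y₁)
        respect refl refl refl = refl

    flip⇒ : ∀ σ → sat σ flipᶠ → ¬ ¬ Σ Carrier λ x′ → H (evalT σ xᵥ) (ev σ zᵥ) (ev σ yᵥ) x′ (ev σ yᵥ) × G x′ (ev σ zᵥ) (ev σ yᵥ)
    flip⇒ σ s n = s λ d b → n (d , subst id (flip-body σ d) b)

    flip⇐ : ∀ σ → ¬ ¬ (Σ Carrier λ x′ → H (evalT σ xᵥ) (ev σ zᵥ) (ev σ yᵥ) x′ (ev σ yᵥ) × G x′ (ev σ zᵥ) (ev σ yᵥ)) → sat σ flipᶠ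
    flip⇐ σ s n = s λ (d , b) → n d (subst id (sym (flip-body σ d)) b)

    rot-G : ∀ σ → sat σ (atom (Gₐ xᵥ (rot zᵥ) yᵥ)) ≡ G (evalT σ xᵥ) (rot (ev σ zᵥ)) (ev σ yᵥ)
    rot-G σ = trans (satG σ xᵥ (rot zᵥ) yᵥ) (cong (λ z → G (evalT σ xᵥ) z (ev σ yᵥ)) (map-rot (evalT σ) zᵥ))

    push-G : ∀ σ → sat σ (atom (Gₐ xᵥ zᵥ (push yᵥ (head zᵥ)))) ≡ G (evalT σ xᵥ) (ev σ zᵥ) (push (ev σ yᵥ) (head (ev σ zᵥ)))
    push-G σ = trans (satG σ xᵥ zᵥ (push yᵥ (head zᵥ))) (cong (G (evalT σ xᵥ) (ev σ zᵥ)) (map-push (evalT σ) yᵥ (head zᵥ)))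

    rot-H : ∀ σ → sat σ (atom (Hₐ xᵥ (rot zᵥ) yᵥ x′ᵥ wᵥ)) ≡ H (evalT σ xᵥ) (rot (ev σ zᵥ)) (ev σ yᵥ) (evalT σ x′ᵥ) (ev σ wᵥ)
    rot-H σ = trans (satH σ xᵥ (rot zᵥ) yᵥ x′ᵥ wᵥ)
      (cong (λ z → H (evalT σ xᵥ) z (ev σ yᵥ) (evalT σ x′ᵥ) (ev σ wᵥ)) (map-rot (evalT σ) zᵥ))

    push-H : ∀ σ → sat σ (atom (Hₐ xᵥ zᵥ yᵥ x′ᵥ (push wᵥ (head zᵥ))))
      ≡ H (evalT σ xᵥ) (ev σ zᵥ) (ev σ yᵥ) (evalT σ x′ᵥ) (push (ev σ wᵥ) (head (ev σ zᵥ)))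
    push-H σ = trans (satH σ xᵥ zᵥ yᵥ x′ᵥ (push wᵥ (head zᵥ)))
      (cong (H (evalT σ xᵥ) (ev σ zᵥ) (ev σ yᵥ) (evalT σ x′ᵥ)) (map-push (evalT σ) wᵥ (head zᵥ)))

    bodyG⇒ : ∀ σ → sat σ bodyG → BodyG (evalT σ xᵥ) (ev σ zᵥ) (ev σ yᵥ)
    bodyG⇒ σ (a , b , c , d) = subst id (rot-G σ) a , subst id (push-G σ) b , distinct⇒ σ (head zᵥ) (tail zᵥ) c , flip⇒ σ d

    bodyG⇐ : ∀ σ → BodyG (evalT σ xᵥ) (ev σ zᵥ) (ev σ yᵥ) → sat σ bodyG
    bodyG⇐ σ (a , b , c , d) = subst id (sym (rot-G σ)) a , subst id (sym (push-G σ)) b , distinct⇐ σ (head zᵥ) (tail zᵥ) c , flip⇐ σ d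

    bodyH⇒ : ∀ σ → sat σ bodyH → BodyH (evalT σ xᵥ) (ev σ zᵥ) (ev σ yᵥ) (evalT σ x′ᵥ) (ev σ wᵥ)
    bodyH⇒ σ (a , b , c , d) = subst id (rot-H σ) a , subst id (push-H σ) b , c ∘ equal⇐ σ yᵥ wᵥ , equal⇒ σ yᵥ wᵥ ∘ d

    bodyH⇐ : ∀ σ → BodyH (evalT σ xᵥ) (ev σ zᵥ) (ev σ yᵥ) (evalT σ x′ᵥ) (ev σ wᵥ) → sat σ bodyH
    bodyH⇐ σ (a , b , c , d) = subst id (sym (rot-H σ)) a , subst id (sym (push-H σ)) b , c ∘ equal⇒ σ yᵥ wᵥ , equal⇐ σ yᵥ wᵥ ∘ d

    env : ∀ {n} → Vec Carrier n → Env
    env []      i       = elem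
    env (c ∷ v) zero    = c
    env (c ∷ v) (suc i) = env v i

    ev-block : ∀ o {n} (v : Vec Carrier n) σ → (∀ i → σ (o + i) ≡ env v i) → ev σ (block o n) ≡ v
    ev-block o []      σ e = refl
    ev-block o (c ∷ v) σ e = cong₂ _∷_ (trans (cong σ (sym (+-identityʳ o))) (e 0))
      (ev-block (suc o) v σ λ i → trans (cong σ (sym (+-suc o i))) (e (suc i)))

    -- Every tuple is the value of the guard variables in the environment that lists it, so
    -- statements about environments become statements about tuples.
    readG : (B : Carrier → Word → Word → Set) → (∀ σ → B (evalT σ xᵥ) (ev σ zᵥ) (ev σ yᵥ)) → ∀ x z y → B x z y
    readG B b x z y = subst₂ (B x) z≡ y≡ (b (env (x ∷ z ++ᵛ y)))
      where
      σ = env (x ∷ z ++ᵛ y)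
      all≡ : ev σ zᵥ ++ᵛ ev σ yᵥ ≡ z ++ᵛ y
      all≡ = trans (sym (map-++ (evalT σ) zᵥ yᵥ)) (∷-injectiveʳ
        (subst (λ ts → ev σ ts ≡ x ∷ z ++ᵛ y) guardG≡ (ev-block 0 (x ∷ z ++ᵛ y) σ λ _ → refl)))
      z≡ = proj₁ (++-injective (ev σ zᵥ) z all≡)
      y≡ = proj₂ (++-injective (ev σ zᵥ) z all≡)

    readH : (B : Carrier → Word → Word → Carrier → Word → Set) →
      (∀ σ → B (evalT σ xᵥ) (ev σ zᵥ) (ev σ yᵥ) (evalT σ x′ᵥ) (ev σ wᵥ)) → ∀ x z y x′ w → B x z y x′ w
    readH B b x z y x′ w = subst₂ (λ z y → B x z y x′ w) z≡ y≡ (subst₂ (B x (ev σ zᵥ) (ev σ yᵥ)) (∷-injectiveˡ rest≡) (∷-injectiveʳ rest≡) (b σ))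
      where
      v = x ∷ z ++ᵛ (y ++ᵛ (x′ ∷ w))
      σ = env v
      all≡ : ev σ zᵥ ++ᵛ (ev σ yᵥ ++ᵛ ev σ (x′ᵥ ∷ wᵥ)) ≡ z ++ᵛ (y ++ᵛ (x′ ∷ w))
      all≡ = trans (sym (trans (map-++ (evalT σ) zᵥ _) (cong (ev σ zᵥ ++ᵛ_) (map-++ (evalT σ) yᵥ _))))
        (∷-injectiveʳ (subst (λ ts → ev σ ts ≡ v) guardH≡ (ev-block 0 v σ λ _ → refl)))
      z≡ = proj₁ (++-injective (ev σ zᵥ) z all≡)
      tail≡ = proj₂ (++-injective (ev σ zᵥ) z all≡)
      y≡ = proj₁ (++-injective (ev σ yᵥ) y tail≡)
      rest≡ = proj₂ (++-injective (ev σ yᵥ) y tail≡)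

    universal : ∀ xs χ {ρ} → Vars (_∈ xs) (fv χ) → sat ρ (∀' xs χ) → ∀ σ → sat σ χ
    universal xs χ v s σ = sat-cong χ (λ i → updAll-∈ (v i)) (allQ-elim xs s σ)

    flipSystem : M ⊨ φ → FlipSystem Carrier h
    flipSystem (s , sG , sH) = record
      { G = G ; H = H ; P = P
      ; P-stable = λ n k → n λ p → p k
      ; G-start  = do
          σ , _ , g , _ ← exQ-elim (upTo gA) s
          return (evalT σ xᵥ , ev σ zᵥ , ev σ yᵥ , subst id (satG σ xᵥ zᵥ yᵥ) g)
      ; G-rot    = λ {x} {z} {y} g → proj₁ (factG x z y g)
      ; G-push   = λ {x} {z} {y} g → proj₁ (proj₂ (factG x z y g))
      ; G-fresh  = λ {x} {z} {y} g → proj₁ (proj₂ (proj₂ (factG x z y g)))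
      ; G-flip   = λ {x} {z} {y} g → proj₂ (proj₂ (proj₂ (factG x z y g)))
      ; H-rot    = λ {x} {z} {y} {x′} {w} g → proj₁ (factH x z y x′ w g)
      ; H-push   = λ {x} {z} {y} {x′} {w} g → proj₁ (proj₂ (factH x z y x′ w g))
      ; H-same   = λ {x} {z} {y} {x′} {w} g ne → let same = proj₂ (proj₂ (proj₂ (factH x z y x′ w g))) in
          (λ p n → same (λ (f , _) → f p n) ne) , (λ p n → same (λ (_ , f) → f p n) ne)
      ; H-differ = λ {x} {z} {y} {x′} g → proj₁ (proj₂ (proj₂ (factH x z y x′ y g))) (return refl)
      }
      where
      factG : ∀ x z y → G x z y → BodyG x z y
      factG = readG (λ x z y → G x z y → BodyG x z y) (λ σ g → bodyG⇒ σ
        (universal (upTo gA) (atom guardG ⇒' bodyG) stepG-Vars sG σ (subst id (sym (satG σ xᵥ zᵥ yᵥ)) g)))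

      factH : ∀ x z y x′ w → H x z y x′ w → BodyH x z y x′ w
      factH = readH (λ x z y x′ w → H x z y x′ w → BodyH x z y x′ w) (λ σ g → bodyH⇒ σ
        (universal (upTo hA) (atom guardH ⇒' bodyH) stepH-Vars sH σ (subst id (sym (satH σ xᵥ zᵥ yᵥ x′ᵥ wᵥ)) g)))

    isModel : ∀ x z y → G x z y → (∀ x z y → G x z y → BodyG x z y) →
      (∀ x z y x′ w → H x z y x′ w → BodyH x z y x′ w) → M ⊨ φ
    isModel x z y g factG factH =
        exQ-stable (upTo gA) (λ _ → sat-stable (atom guardG ∧' atom guardG))
          (readG (λ x z y → G x z y → ¬ ¬ sat (λ _ → elem) start) existential x z y g)
      , allQ-intro (upTo gA) (λ σ _ s → bodyG⇐ σ (factG _ (ev σ zᵥ) (ev σ yᵥ) (subst id (satG σ xᵥ zᵥ yᵥ) s)))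
      , allQ-intro (upTo hA) (λ σ _ s → bodyH⇐ σ (factH _ (ev σ zᵥ) (ev σ yᵥ) _ (ev σ wᵥ) (subst id (satH σ xᵥ zᵥ yᵥ x′ᵥ wᵥ) s)))
      where
      existential : ∀ σ → G (evalT σ xᵥ) (ev σ zᵥ) (ev σ yᵥ) → ¬ ¬ sat (λ _ → elem) start
      existential σ g = return (exQ-intro (upTo gA) σ (g′ , g′))
        where
        g′ = sat-cong (atom guardG) {σ} (λ i → sym (updAll-∈ (∈-upTo⁺ (guardG-< i)))) (subst id (sym (satG σ xᵥ zᵥ yᵥ)) g)

  -- A model of the sentence.

  module FlipModel (h : ℕ) where
    open Flip h

    -- Only satisfiability is asked for, so the model may be infinite: the letters are all natural
    -- numbers and the nodes are all bit patterns on words of numbers. Flipping one bit is then a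
    -- total operation.
    C₀ : Set
    C₀ = ℕ ⊎ (Vec ℕ k → Bool)

    Letters : Vec C₀ k → Set
    Letters z = Σ (Vec ℕ k) λ zs → z ≡ Vec.map inj₁ zs

    flipAt : Vec ℕ k → (Vec ℕ k → Bool) → Vec ℕ k → Bool
    flipAt ys f ws = if does (Vec-≡-dec _≟_ ys ws) then not (f ws) else f ws

    G₀ : C₀ → Vec C₀ k → Vec C₀ k → Set
    G₀ x z y = (Σ (Vec ℕ k → Bool) λ f → x ≡ inj₂ f) × Letters z × Letters y × Unique z

    H₀ : C₀ → Vec C₀ k → Vec C₀ k → C₀ → Vec C₀ k → Set
    H₀ x z y x′ w = Σ (Vec ℕ k → Bool) λ f → Σ (Vec ℕ k) λ ys →
      x ≡ inj₂ f × x′ ≡ inj₂ (flipAt ys f) × y ≡ Vec.map inj₁ ys × Letters z × Letters w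

    P₀ : C₀ → Vec C₀ k → Set
    P₀ x w = Σ (Vec ℕ k → Bool) λ f → Σ (Vec ℕ k) λ ws → x ≡ inj₂ f × w ≡ Vec.map inj₁ ws × f ws ≡ true

    -- Arguments are compared as lists, since a relation symbol may carry any arity.
    rel₀ : (R : RelSym) → Vec C₀ (RelSym.arity R) → Set
    rel₀ (rsym 0 _) v = Σ C₀ λ x → Σ (Vec C₀ k) λ z → Σ (Vec C₀ k) λ y →
      toList v ≡ toList (x ∷ z ++ᵛ y) × G₀ x z y
    rel₀ (rsym 1 _) v = Σ C₀ λ x → Σ (Vec C₀ k) λ z → Σ (Vec C₀ k) λ y → Σ C₀ λ x′ → Σ (Vec C₀ k) λ w →
      toList v ≡ toList (x ∷ z ++ᵛ (y ++ᵛ (x′ ∷ w))) × H₀ x z y x′ w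
    rel₀ (rsym 2 _) v = Σ C₀ λ x → Σ (Vec C₀ k) λ w → toList v ≡ toList (x ∷ w) × P₀ x w
    rel₀ _ v = ⊥

    M₀ : Structure
    M₀ = record { Carrier = C₀ ; elem = inj₁ 0 ; relI = rel₀ ; conI = λ _ → inj₁ 0 }

    open FlipSemantics h M₀

    G⇒G₀ : ∀ x z y → rel₀ Gₛ (x ∷ z ++ᵛ y) → G₀ x z y
    G⇒G₀ x z y (x₁ , z₁ , y₁ , e , g) with eq ← toList-inj {u = x ∷ z ++ᵛ y} {x₁ ∷ z₁ ++ᵛ y₁} e
      with refl ← ∷-injectiveˡ eq | refl , refl ← ++-injective z z₁ (∷-injectiveʳ eq) = g

    H⇒H₀ : ∀ x z y x′ w → rel₀ Hₛ (x ∷ z ++ᵛ (y ++ᵛ (x′ ∷ w))) → H₀ x z y x′ w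
    H⇒H₀ x z y x′ w (x₁ , z₁ , y₁ , x₁′ , w₁ , e , g)
      with eq ← toList-inj {u = x ∷ z ++ᵛ (y ++ᵛ (x′ ∷ w))} {x₁ ∷ z₁ ++ᵛ (y₁ ++ᵛ (x₁′ ∷ w₁))} e
      with refl ← ∷-injectiveˡ eq | refl , eq′ ← ++-injective z z₁ (∷-injectiveʳ eq)
      with refl , refl ← ++-injective y y₁ eq′ = g

    P⇒P₀ : ∀ {x w} → rel₀ Pₛ (x ∷ w) → P₀ x w
    P⇒P₀ {x} {w} (x₁ , w₁ , e , p) with refl ← toList-inj {u = x ∷ w} {x₁ ∷ w₁} e = p

    Letters-rot : ∀ {z} → Letters z → Letters (rot z)
    Letters-rot (zs , refl) = rot zs , sym (map-rot inj₁ zs)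

    Letters-push : ∀ {y z} → Letters y → Letters z → Letters (push y (head z))
    Letters-push (ys , refl) (c ∷ zs , refl) = push ys c , sym (map-push inj₁ ys c)

    Unique-rot : ∀ {A : Set} {n} {v : Vec A (suc n)} → Unique v → Unique (rot v)
    Unique-rot {v = a ∷ v} (p ∷ u) = snoc v p u
      where
      All-snoc : ∀ {P n} {v : Vec _ n} → AllV P v → P a → AllV P (v ∷ʳ a)
      All-snoc []ᵛ       q = q ∷ᵛ []ᵛ
      All-snoc (p ∷ᵛ ps) q = p ∷ᵛ All-snoc ps q

      snoc : ∀ {n} (v : Vec _ n) → AllV (a ≢_) v → Unique v → Unique (v ∷ʳ a)
      snoc []      []ᵛ       []      = []ᵛ ∷ []
      snoc (b ∷ v) (p ∷ᵛ ps) (q ∷ u) = All-snoc q (p ∘ sym) ∷ snoc v ps u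

    Unique-head : ∀ {A : Set} {n} {v : Vec A (suc n)} → Unique v → head v ∉ toList (tail v)
    Unique-head {v = a ∷ v} (p ∷ u) i = absent p i
      where
      absent : ∀ {n} {v : Vec _ n} → AllV (a ≢_) v → a ∉ toList v
      absent (p ∷ᵛ ps) (here e)  = p e
      absent (p ∷ᵛ ps) (there i) = absent ps i

    factG : ∀ x z y → G x z y → BodyG x z y
    factG x z y g =
        (λ n → g λ r → let f , lz , ly , u = G⇒G₀ x z y r in n (x , rot z , y , refl , f , Letters-rot lz , ly , Unique-rot u))
      , (λ n → g λ r → let f , lz , ly , u = G⇒G₀ x z y r in n (x , z , push y (head z) , refl , f , lz , Letters-push ly lz , u))
      , (λ i → g λ r → let f , lz , ly , u = G⇒G₀ x z y r in Unique-head u i)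
      , (λ n → g λ r → let (f , f≡) , lz , ly@(ys , y≡) , u = G⇒G₀ x z y r in
          n (inj₂ (flipAt ys f) , return (x , z , y , _ , y , refl , f , ys , f≡ , refl , y≡ , lz , ly)
                                , return (_ , z , y , refl , (_ , refl) , lz , ly , u)))

    map-inj₁-injective : ∀ {n} {u v : Vec ℕ n} → Vec.map {B = C₀} inj₁ u ≡ Vec.map inj₁ v → u ≡ v
    map-inj₁-injective {u = []}    {[]}    e = refl
    map-inj₁-injective {u = _ ∷ _} {_ ∷ _} e =
      cong₂ _∷_ (inj₁-injective (∷-injectiveˡ e)) (map-inj₁-injective (∷-injectiveʳ e))

    P⇒ : ∀ {f ws} → P (inj₂ f) (Vec.map inj₁ ws) → f ws ≡ true
    P⇒ {f} {ws} p = decidable-stable (f ws ≟ᵇ true) λ n → p λ r → n (at (P⇒P₀ r))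
      where
      at : P₀ (inj₂ f) (Vec.map inj₁ ws) → f ws ≡ true
      at (f₁ , ws₁ , refl , e , t) = subst (λ ws → f ws ≡ true) (sym (map-inj₁-injective e)) t

    ⇒P : ∀ {f ws} → f ws ≡ true → P (inj₂ f) (Vec.map inj₁ ws)
    ⇒P t = return (_ , _ , refl , _ , _ , refl , refl , t)

    flipAt-differ : ∀ ys f → ¬ ((f ys ≡ true → flipAt ys f ys ≡ true) × (flipAt ys f ys ≡ true → f ys ≡ true))
    flipAt-differ ys f (p , q) with Vec-≡-dec _≟_ ys ys
    ... | no ne = ne refl
    ... | yes _ with f ys
    ...   | true  = contradiction (p refl) λ ()
    ...   | false = contradiction (q refl) λ ()

    flipAt-same : ∀ {ys ws} f → ys ≢ ws → flipAt ys f ws ≡ f ws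
    flipAt-same {ys} {ws} f ne with Vec-≡-dec _≟_ ys ws
    ... | yes e = contradiction e ne
    ... | no _  = refl

    factH : ∀ x z y x′ w → H x z y x′ w → BodyH x z y x′ w
    factH x z y x′ w g =
        (λ n → g λ r → let f , ys , a , b , c , lz , lw = H⇒H₀ x z y x′ w r in
           n (x , rot z , y , x′ , w , refl , f , ys , a , b , c , Letters-rot lz , lw))
      , (λ n → g λ r → let f , ys , a , b , c , lz , lw = H⇒H₀ x z y x′ w r in
           n (x , z , y , x′ , push w (head z) , refl , f , ys , a , b , c , lz , Letters-push lw lz))
      , (λ e i → e λ y≡w → g λ r → differ (H⇒H₀ x z y x′ w r) y≡w i)
      , (λ n e → g λ r → same (H⇒H₀ x z y x′ w r) n e)
      where
      differ : H₀ x z y x′ w → y ≡ w → ¬ ((P x w → P x′ w) × (P x′ w → P x w))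
      differ (f , ys , refl , refl , refl , lz , lw) refl (p , q) =
        flipAt-differ ys f (P⇒ ∘ p ∘ ⇒P , P⇒ ∘ q ∘ ⇒P)

      same : H₀ x z y x′ w → ¬ ((P x w → P x′ w) × (P x′ w → P x w)) → ¬ ¬ (y ≡ w)
      same (f , ys , refl , refl , refl , lz , ws , refl) n ne =
        n ( (λ p → ⇒P (trans (flipAt-same f (ne ∘ cong (Vec.map inj₁))) (P⇒ p)))
          , (λ p → ⇒P (trans (sym (flipAt-same f (ne ∘ cong (Vec.map inj₁)))) (P⇒ p))))

    satisfiable : Satisfiable φ
    satisfiable = M₀ , isModel (inj₂ λ _ → false) z z
      (return (_ , z , z , refl , (_ , refl) , (zs , refl) , (zs , refl) , unique)) factG factH
      where
      zs : Vec ℕ k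
      zs = tabulate toℕ
      z : Vec C₀ k
      z = Vec.map inj₁ zs
      unique : Unique z
      unique = Unique.map⁺ inj₁-injective (Unique.tabulate⁺ toℕ-injective)

open LowerBound

-- The constants and the two bounds.

open import Data.Integer using (+_)
open import Data.Rational using (ℚ; 0ℚ; _/_; _<_) renaming (_<?_ to _<ℚ?_)

^-distribʳ-* : ∀ m n o → (m * n) ^ o ≡ m ^ o * n ^ o
^-distribʳ-* m n zero    = refl
^-distribʳ-* m n (suc o) = trans (cong (m * n *_) (^-distribʳ-* m n o)) (*-interchange m n (m ^ o) (n ^ o))
  where
  *-interchange : ∀ a b c d → a * b * (c * d) ≡ a * c * (b * d)
  *-interchange = [m*n]*[o*p]≡[m*o]*[n*p]

-- The exponent n^(p n / q) need not be a natural number; it is replaced by any natural `T` above it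
-- with 2^T ≤ m.
DExpAtLeast-intro : ∀ p q n {m} T → 2 ^ T ≤ m → n ^ (p * n) ≤ T ^ q → DExpAtLeast′ p q n m
DExpAtLeast-intro p q n {m} T 2^T≤m n≤T a b 1≤b lt = begin
  b ^ q * n ^ (p * n)  ≤⟨ *-monoʳ-≤ (b ^ q) n≤T ⟩
  b ^ q * T ^ q        ≡⟨ ^-distribʳ-* b T q ⟨
  (b * T) ^ q          ≤⟨ ^-monoˡ-≤ q (≮⇒≥ λ a<b*T → <⇒≱ lt (≤-trans (^-monoʳ-≤ 2 (<⇒≤ a<b*T)) power)) ⟩
  a ^ q                ∎
  where
  open ≤-Reasoning
  power : 2 ^ (b * T) ≤ m ^ b
  power = begin
    2 ^ (b * T)  ≡⟨ cong (2 ^_) (*-comm b T) ⟩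
    2 ^ (T * b)  ≡⟨ ^-*-assoc 2 T b ⟨
    (2 ^ T) ^ b  ≤⟨ ^-monoˡ-≤ b 2^T≤m ⟩
    m ^ b        ∎

power-≤ : ∀ c k N .{{_ : NonZero k}} → N ≤ c * k → c ≤ k → N ^ (1 * N) ≤ (k ^ k) ^ (c * 2)
power-≤ c k N N≤ck c≤k = begin
  N ^ (1 * N)         ≡⟨ cong (N ^_) (*-identityˡ N) ⟩
  N ^ N               ≤⟨ ^-monoˡ-≤ N (≤-trans N≤ck (*-monoˡ-≤ k c≤k)) ⟩
  (k * k) ^ N         ≤⟨ ^-monoʳ-≤ (k * k) {{m*n≢0 k k}} N≤ck ⟩
  (k * k) ^ (c * k)   ≡⟨ cong (λ x → (k * x) ^ (c * k)) (*-identityʳ k) ⟨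
  (k ^ 2) ^ (c * k)   ≡⟨ ^-*-assoc k 2 (c * k) ⟩
  k ^ (2 * (c * k))   ≡⟨ cong (k ^_) (trans (sym (*-assoc 2 c k)) (trans (*-comm (2 * c) k) (cong (k *_) (*-comm 2 c)))) ⟩
  k ^ (k * (c * 2))   ≡⟨ ^-*-assoc k k (c * 2) ⟨
  (k ^ k) ^ (c * 2)   ∎
  where open ≤-Reasoning

-- Slope 47 in place of 46 absorbs the additive constant: 146 = 47 + 99, and the 99 is paid by the
-- extra `h`.
length-≤ : ∀ h → 99 ≤ h → 146 + 46 * h ≤ 47 * suc h
length-≤ h 99≤h = begin
  47 + (99 + 46 * h)  ≤⟨ +-monoʳ-≤ 47 (+-monoˡ-≤ (46 * h) 99≤h) ⟩
  47 + 47 * h         ≡⟨ *-suc 47 h ⟨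
  47 * suc h          ∎
  where open ≤-Reasoning

upper : (φ : Formula) → GF φ → Sentence φ → Satisfiable φ →
  Σ Structure λ M → (M ⊨ φ) × Σ ℕ λ m → (Structure.Carrier M ↔ Fin m) × DExpAtMost (+ 3 / 1) (len φ) m
upper φ gf sentence (M , M⊨φ) =
  let m , m≤ , C , C⊨φ = boundedModel M φ gf sentence M⊨φ in
  Coding.decode m (rels φ) (cons φ) C , C⊨φ , m , ↔-id _
  , DExpAtMost-intro 3 (len φ) (≤-trans m≤ (sizeBound-≤ (len φ) (3≤len φ)))

-- 94 = 2 · 47: from n ≤ 47 k and n ≤ k² one gets n ^ n ≤ (k²) ^ (47 k) = (k ^ k) ^ 94.
DExpAtLeast-k^k : ∀ n k .{{_ : NonZero k}} {m} → n ≤ 47 * k → 47 ≤ k → 2 ^ (k ^ k) ≤ m → DExpAtLeast (+ 1 / 94) n m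
DExpAtLeast-k^k n k n≤47k 47≤k 2^≤m = DExpAtLeast-intro 1 94 n (k ^ k) 2^≤m (power-≤ 47 k n n≤47k 47≤k)

lowerAt : ∀ n h → n ≤ h → 99 ≤ h → Σ Formula λ φ → GF φ × Sentence φ × Satisfiable φ × (n ≤ len φ)
  × ((M : Structure) → M ⊨ φ → (m : ℕ) → (Structure.Carrier M ↣ Fin m) → DExpAtLeast (+ 1 / 94) (len φ) m)
lowerAt n h n≤h 99≤h = φ , φ-GF , φ-sentence , FlipModel.satisfiable h , subst (n ≤_) (sym φ-len) (≤-trans n≤h h≤len)
  , λ M M⊨φ m ι → DExpAtLeast-k^k (len φ) k (subst (_≤ 47 * k) (sym φ-len) (length-≤ h 99≤h))
      (≤-trans (m≤m+n 47 52) (m≤n⇒m≤1+n 99≤h))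
      (Patterns.size-≥ (FlipSemantics.flipSystem h M M⊨φ) (Injection.to ι) (Injection.injective ι))
  where
  open Flip h
  h≤len : h ≤ 146 + 46 * h
  h≤len = ≤-trans (m≤m*n h 46) (≤-trans (≤-reflexive (*-comm h 46)) (m≤n+m (46 * h) 146))

lower : (n : ℕ) → Σ Formula λ φ → GF φ × Sentence φ × Satisfiable φ × (n ≤ len φ)
  × ((M : Structure) → M ⊨ φ → (m : ℕ) → (Structure.Carrier M ↣ Fin m) → DExpAtLeast (+ 1 / 94) (len φ) m)
-- The summand 99 meets the threshold of `length-≤`, and `n` makes the sentence long enough.
lower n = lowerAt n (99 + n) (m≤n+m n 99) (m≤m+n 99 n)

theorem1 : Σ ℚ λ Clb → Σ ℚ λ Cub → (0ℚ < Clb) × (Clb < Cub)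
    × ((φ : Formula) → GF φ → Sentence φ → Satisfiable φ →
    Σ Structure λ M → (M ⊨ φ)
    × Σ ℕ λ m → (Structure.Carrier M ↔ Fin m) × DExpAtMost Cub (len φ) m)
    × ((n : ℕ) → Σ Formula λ φ → GF φ × Sentence φ × Satisfiable φ × (n ≤ len φ)
    × ((M : Structure) → M ⊨ φ → (m : ℕ) → (Structure.Carrier M ↣ Fin m)
    → DExpAtLeast Clb (len φ) m))
theorem1 = + 1 / 94 , + 3 / 1 , from-yes (0ℚ <ℚ? (+ 1 / 94)) , from-yes ((+ 1 / 94) <ℚ? (+ 3 / 1)) , upper , lower
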